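{- $\mathrm{BPf}^{\mathtt R}=\mathcal D_T$; in particular also $\mathrm{BP}^{\mathtt R}=\mathcal D_T$.
   Context: Types $\sigma,\tau::=\mathbb N\mid\sigma\to\tau\mid\sigma\times\tau$; $T^{\mathtt R}$ terms $M,N::=x\mid\lambda x.M\mid MN\mid\langle M,N\rangle\mid\pi_1\mid\pi_2\mid\mathtt{rec}\mid\mathtt 0\mid\mathtt S\mid\mathtt R$, simply typed with $\mathtt 0:\mathbb N$, $\mathtt S:\mathbb N\to\mathbb N$, $\mathtt{rec}:(\sigma\times(\mathbb N\to\sigma\to\sigma)\times\mathbb N)\to\sigma$, $\pi_1:(\sigma\times\tau)\to\sigma$, $\pi_2:(\sigma\times\tau)\to\tau$, $\mathtt R:\mathbb N$; Gödel's System T is the fragment without $\mathtt R$. Numerals $\mathbf 0=\mathtt 0$, $\mathbf{n+1}=\mathtt S\mathbf n$. Values: closed terms of $V,W::=\lambda x.M\mid\pi_1\mid\pi_2\mid\langle V,W\rangle\mid\mathtt{rec}\mid\mathtt 0\mid\mathtt S\mid\mathtt SV$. Weak call-by-value reduction to (sub)distributions: $(\lambda x.M)V\to\{M[V/x]\}$; if $M\to\mu$ then $MV\to\mu V$ (pushforward); if $N\to\nu$ then $MN\to M\nu$; pairs left then right; $\mathtt{rec}\langle U,V,\mathtt 0\rangle\to\{U\}$; $\mathtt{rec}\langle U,V,\mathtt S\mathbf n\rangle\to\{V\mathbf n(\mathtt{rec}\langle U,V,\mathbf n\rangle)\}$; $\pi_i$ project pairs of values; $\mathtt R\to\{\mathbf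 n\mapsto2^{ -(n+1)}\}_n$; lifted to distributions. Evaluation $[\![M]\!](V)=\lim_k\mu_k(V)$, $\mu_0=\{M\}$, $\mu_{k+1}$ the reduct of $\mu_k$. $\mathcal D_T$: the $f:\mathbb N\to\mathbb N$ such that some closed System T term $M:\mathbb N\to\mathbb N$ reduces $M\mathbf n$ to $\mathbf{f(n)}$ for all $n$. $\mathrm{BP}^{\mathtt R}$: the $f$ with a closed $M:\mathbb N\to\mathbb N$ in $T^{\mathtt R}$ with $[\![M\mathbf n]\!](\mathbf{f(n)})\ge\frac23$ for all $n$. $\mathrm{BPf}^{\mathtt R}$: the $f$ for which there are $h\in\mathcal D_T$ (with $h(n)\ne0$) and closed $M:\mathbb N\to\mathbb N$ in $T^{\mathtt R}$ with $[\![M\mathbf n]\!](\mathbf{f(n)})>\frac12+\frac1{h(n)}$ for all $n$. -}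

module Defs where

open import Data.Nat as ℕ using (ℕ; zero; suc)
open import Data.Bool using (Bool; true; false; _∧_; if_then_else_)
open import Data.List using (List; []; _∷_; map; concatMap; upTo; foldr)
open import Data.Product using (Σ; _×_; _,_; ∃)
open import Data.Integer using (+_)
open import Data.Rational using (ℚ; 0ℚ; 1ℚ; ½; _+_; _*_; _-_; _<_; _/_)
open import Data.Unit using (⊤)
open import Relation.Binary.PropositionalEquality using (_≡_; _≢_)

infixr 7 _⇒_
infixr 8 _⊗_
data Ty : Set where
  nat : Ty
  _⇒_ : Ty → Ty → Ty
  _⊗_ : Ty → Ty → Ty

data Tm : Set where
  var  : ℕ → Tm
  lam  : Tm → Tm
  app  : Tm → Tm → Tm
  pair : Tm → Tm → Tm
  pi1  : Tm
  pi2  : Tm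
  rec  : Tm
  zer  : Tm
  suk  : Tm
  rnd  : Tm

num : ℕ → Tm
num zero    = zer
num (suc n) = app suk (num n)

triple : Tm → Tm → Tm → Tm
triple U V W = pair U (pair V W)

data _∋_∶_ : List Ty → ℕ → Ty → Set where
  here  : ∀ {Γ σ} → (σ ∷ Γ) ∋ zero ∶ σ
  there : ∀ {Γ σ τ i} → Γ ∋ i ∶ σ → (τ ∷ Γ) ∋ suc i ∶ σ

data _⊢_∶_ (Γ : List Ty) : Tm → Ty → Set where
  ⊢var  : ∀ {i σ} → Γ ∋ i ∶ σ → Γ ⊢ var i ∶ σ
  ⊢lam  : ∀ {M σ τ} → (σ ∷ Γ) ⊢ M ∶ τ → Γ ⊢ lam M ∶ (σ ⇒ τ)
  ⊢app  : ∀ {M N σ τ} → Γ ⊢ M ∶ (σ ⇒ τ) → Γ ⊢ N ∶ σ → Γ ⊢ app M N ∶ τ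
  ⊢pair : ∀ {M N σ τ} → Γ ⊢ M ∶ σ → Γ ⊢ N ∶ τ → Γ ⊢ pair M N ∶ (σ ⊗ τ)
  ⊢pi1  : ∀ {σ τ} → Γ ⊢ pi1 ∶ ((σ ⊗ τ) ⇒ σ)
  ⊢pi2  : ∀ {σ τ} → Γ ⊢ pi2 ∶ ((σ ⊗ τ) ⇒ τ)
  ⊢rec  : ∀ {σ} → Γ ⊢ rec ∶ ((σ ⊗ ((nat ⇒ σ ⇒ σ) ⊗ nat)) ⇒ σ)
  ⊢zer  : Γ ⊢ zer ∶ nat
  ⊢suk  : Γ ⊢ suk ∶ (nat ⇒ nat)
  ⊢rnd  : Γ ⊢ rnd ∶ nat

-- R-free terms: Gödel's System T fragment
NoR : Tm → Set
NoR (var _)    = ⊤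
NoR (lam M)    = NoR M
NoR (app M N)  = NoR M × NoR N
NoR (pair M N) = NoR M × NoR N
NoR pi1 = ⊤
NoR pi2 = ⊤
NoR rec = ⊤
NoR zer = ⊤
NoR suk = ⊤
NoR rnd = Data.Empty.⊥
  where import Data.Empty

-- Substitution of a closed value V for the variable k

subst : ℕ → Tm → Tm → Tm
subst k V (var i) with ℕ.compare i k
... | ℕ.less _ _    = var i
... | ℕ.equal _     = V
... | ℕ.greater _ j = var (k ℕ.+ j)   -- i = suc (k + j), decremented
subst k V (lam M)    = lam (subst (suc k) V M)
subst k V (app M N)  = app (subst k V M) (subst k V N)
subst k V (pair M N) = pair (subst k V M) (subst k V N)
subst k V pi1 = pi1
subst k V pi2 = pi2
subst k V rec = rec
subst k V zer = zer
subst k V suk = suk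
subst k V rnd = rnd

-- One step of weak call-by-value reduction.
-- The redex is determined uniquely; a step is either deterministic,
-- or (for R) a random choice of n with probability 2^-(n+1).

data Step : Set where
  isVal : Step
  det   : Tm → Step
  ran   : (ℕ → Tm) → Step  -- M → {g n ↦ 2^-(n+1)}_n
  stuck : Step

redex : Tm → Tm → Step
redex (lam M) V = det (subst 0 V M)
redex pi1 (pair V W) = det V
redex pi2 (pair V W) = det W
redex rec (pair U (pair V zer)) = det U
redex rec (pair U (pair V (app suk W))) = det (app (app V W) (app rec (triple U V W)))
redex suk V = isVal
redex _ _ = stuck

step : Tm → Step
step (var _) = stuck
step (lam M) = isVal
step (app M N) with step N
... | det N' = det (app M N')
... | ran g  = ran (λ n → app M (g n))
... | stuck  = stuck
... | isVal with step M
...   | det M' = det (app M' N)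
...   | ran g  = ran (λ n → app (g n) N)
...   | stuck  = stuck
...   | isVal  = redex M N
step (pair M N) with step M
... | det M' = det (pair M' N)
... | ran g  = ran (λ n → pair (g n) N)
... | stuck  = stuck
... | isVal with step N
...   | det N' = det (pair M N')
...   | ran g  = ran (λ n → pair M (g n))
...   | stuck  = stuck
...   | isVal  = isVal
step pi1 = isVal
step pi2 = isVal
step rec = isVal
step zer = isVal
step suk = isVal
step rnd = ran num

data _⟶*_ : Tm → Tm → Set where
  done : ∀ {M} → M ⟶* M
  more : ∀ {M M' N} → step M ≡ det M' → M' ⟶* N → M ⟶* N

-- Subdistributions μ_k, truncated: only the first Nc outcomes of each
-- R-sample are kept (so every truncated μ_k is a finite list).
-- μ_k(V) = sup_Nc (truncated mass), and values/stuck terms persist.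

Dist : Set
Dist = List (ℚ × Tm)

halfPow : ℕ → ℚ
halfPow zero    = ½
halfPow (suc n) = ½ * halfPow n

reduct : ℕ → ℚ × Tm → Dist
reduct Nc (w , M) with step M
... | isVal  = (w , M) ∷ []
... | stuck  = (w , M) ∷ []
... | det M' = (w , M') ∷ []
... | ran g  = map (λ j → (w * halfPow j , g j)) (upTo Nc)

dist : ℕ → ℕ → Tm → Dist
dist Nc zero    M = (1ℚ , M) ∷ []
dist Nc (suc k) M = concatMap (reduct Nc) (dist Nc k M)

_==_ : Tm → Tm → Bool
var i == var j = i ℕ.≡ᵇ j
lam M == lam M' = M == M'
app M N == app M' N' = (M == M') ∧ (N == N')
pair M N == pair M' N' = (M == M') ∧ (N == N')
pi1 == pi1 = true
pi2 == pi2 = true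
rec == rec = true
zer == zer = true
suk == suk = true
rnd == rnd = true
_ == _ = false

massOf : Tm → Dist → ℚ
massOf V = foldr (λ { (w , M) acc → (if M == V then w else 0ℚ) + acc }) 0ℚ

mass : ℕ → ℕ → Tm → Tm → ℚ
mass Nc k M V = massOf V (dist Nc k M)

-- [[M]](V) = lim_k μ_k(V) = sup_k sup_Nc mass (monotone, nonnegative)
EvalGt : Tm → Tm → ℚ → Set
EvalGt M V q = Σ ℕ λ Nc → Σ ℕ λ k → q < mass Nc k M V

EvalGeq : Tm → Tm → ℚ → Set
EvalGeq M V q = (ε : ℚ) → 0ℚ < ε → Σ ℕ λ Nc → Σ ℕ λ k → (q - ε) < mass Nc k M V

-- 1/m as a rational (only used with m ≠ 0)
recip : ℕ → ℚ
recip zero    = 0ℚ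
recip (suc m) = + 1 / suc m

twoThirds : ℚ
twoThirds = + 2 / 3

DT : (ℕ → ℕ) → Set
DT f = Σ Tm λ M → ([] ⊢ M ∶ (nat ⇒ nat)) × NoR M
         × ((n : ℕ) → app M (num n) ⟶* num (f n))

BP : (ℕ → ℕ) → Set
BP f = Σ Tm λ M → ([] ⊢ M ∶ (nat ⇒ nat))
         × ((n : ℕ) → EvalGeq (app M (num n)) (num (f n)) twoThirds)

BPf : (ℕ → ℕ) → Set
BPf f = Σ (ℕ → ℕ) λ h → DT h × ((n : ℕ) → h n ≢ 0)
         × Σ Tm λ M → ([] ⊢ M ∶ (nat ⇒ nat))
         × ((n : ℕ) → EvalGt (app M (num n)) (num (f n)) (½ + recip (h n)))

{-# OPTIONS --safe #-}

-- A T^R program is translated into System T in continuation-passing style, with answers that are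
-- computable subdistributions: at precision s, an answer is a finitely supported one with rational
-- weights that lies below the true output distribution and misses at most 2^-s of any outcome's
-- mass.  The sampler R becomes the mixture of the first s + 1 continuations, each run at precision
-- s + 1.  At precision h(n) we have 2^-h(n) ≤ 1/h(n), so the correct output still carries more than
-- half of the weight, and a bounded search finds it.  Both the correctness of this translation and
-- the adequacy of the standard model of System T are instances of one logical-relations argument,
-- in which a closed term is related to a denotation along its well-founded evaluation tree.

module Submission where

open import Defs
open import Data.Nat as ℕ using (ℕ; zero; suc; z≤n; s≤s)
open import Data.Product using (∃; _×_; _,_; proj₁; proj₂)
open import Function.Bundles using (_⇔_; mk⇔)

open import Data.Bool using (true; false; if_then_else_)
open import Data.Empty using (⊥; ⊥-elim)
open import Data.Integer as ℤ using (+_)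
import Data.Integer.Properties as ℤ
open import Data.List using (List; []; _∷_; _++_; length; map; concatMap; applyUpTo; foldr)
open import Data.List.Relation.Unary.All using (All; []; _∷_)
import Data.Nat.Properties as ℕ
open import Data.Nat.Tactic.RingSolver using () renaming (solve-∀ to ℕ-solve-∀)
open import Data.Rational using (ℚ; 0ℚ; 1ℚ; ½; _+_; _*_; _-_; -_; _<_; _≤_; _/_; NonNegative; Positive; toℚᵘ)
import Data.Rational.Properties as ℚ
open import Data.Rational.Solver using (module +-*-Solver)
import Data.Rational.Unnormalised as ℚᵘ
import Data.Rational.Unnormalised.Properties as ℚᵘ
open import Data.Unit using (⊤; tt)
open import Function using (_∘_; id; case_of_)
open import Relation.Binary.Definitions using (tri<; tri≈; tri>)
open import Relation.Binary.PropositionalEquality renaming (subst to transport; subst₂ to transport₂)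
open import Relation.Nullary using (yes; no)
open import Relation.Nullary.Decidable using (from-yes)
open +-*-Solver using (solve; _:=_; _:+_; _:*_; _:-_; con)

-- Closed terms and substitution

Scoped : ℕ → Tm → Set
Scoped n (var i)    = i ℕ.< n
Scoped n (lam M)    = Scoped (suc n) M
Scoped n (app M N)  = Scoped n M × Scoped n N
Scoped n (pair M N) = Scoped n M × Scoped n N
Scoped n pi1 = ⊤
Scoped n pi2 = ⊤
Scoped n rec = ⊤
Scoped n zer = ⊤
Scoped n suk = ⊤
Scoped n rnd = ⊤

Scoped-mono : ∀ M {m n} → m ℕ.≤ n → Scoped m M → Scoped n M
Scoped-mono (var i)    m≤n s       = ℕ.≤-trans s m≤n
Scoped-mono (lam M)    m≤n s       = Scoped-mono M (s≤s m≤n) s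
Scoped-mono (app M N)  m≤n (s , t) = Scoped-mono M m≤n s , Scoped-mono N m≤n t
Scoped-mono (pair M N) m≤n (s , t) = Scoped-mono M m≤n s , Scoped-mono N m≤n t
Scoped-mono pi1 _ _ = tt
Scoped-mono pi2 _ _ = tt
Scoped-mono rec _ _ = tt
Scoped-mono zer _ _ = tt
Scoped-mono suk _ _ = tt
Scoped-mono rnd _ _ = tt

∋-bound : ∀ {Γ i σ} → Γ ∋ i ∶ σ → i ℕ.< length Γ
∋-bound here      = s≤s z≤n
∋-bound (there x) = s≤s (∋-bound x)

⊢-scoped : ∀ {Γ M σ} → Γ ⊢ M ∶ σ → Scoped (length Γ) M
⊢-scoped (⊢var x)    = ∋-bound x
⊢-scoped (⊢lam d)    = ⊢-scoped d
⊢-scoped (⊢app d e)  = ⊢-scoped d , ⊢-scoped e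
⊢-scoped (⊢pair d e) = ⊢-scoped d , ⊢-scoped e
⊢-scoped ⊢pi1 = tt
⊢-scoped ⊢pi2 = tt
⊢-scoped ⊢rec = tt
⊢-scoped ⊢zer = tt
⊢-scoped ⊢suk = tt
⊢-scoped ⊢rnd = tt

subst-var-< : ∀ {k i} V → i ℕ.< k → subst k V (var i) ≡ var i
subst-var-< {k} {i} V i<k with ℕ.compare i k
... | ℕ.less _ _    = refl
... | ℕ.equal _     = ⊥-elim (ℕ.<-irrefl refl i<k)
... | ℕ.greater _ j = ⊥-elim (ℕ.<-irrefl refl (ℕ.<-≤-trans i<k (ℕ.m≤n⇒m≤1+n (ℕ.m≤m+n k j))))

subst-var-≡ : ∀ {k i} V → i ≡ k → subst k V (var i) ≡ V
subst-var-≡ {k} {i} V i≡k with ℕ.compare i k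
... | ℕ.less _ j    = ⊥-elim (ℕ.<-irrefl i≡k (s≤s (ℕ.m≤m+n i j)))
... | ℕ.equal _     = refl
... | ℕ.greater _ j = ⊥-elim (ℕ.<-irrefl (sym i≡k) (s≤s (ℕ.m≤m+n k j)))

subst-var-> : ∀ {k i} V → k ℕ.< i → subst k V (var i) ≡ var (ℕ.pred i)
subst-var-> {k} {i} V k<i with ℕ.compare i k
... | ℕ.less _ j    = ⊥-elim (ℕ.<-irrefl refl (ℕ.<-≤-trans k<i (ℕ.m≤n⇒m≤1+n (ℕ.m≤m+n i j))))
... | ℕ.equal _     = ⊥-elim (ℕ.<-irrefl refl k<i)
... | ℕ.greater _ j = refl

subst-scoped-id : ∀ M {n k V} → Scoped n M → n ℕ.≤ k → subst k V M ≡ M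
subst-scoped-id (var i)    {V = V} s n≤k = subst-var-< V (ℕ.≤-trans s n≤k)
subst-scoped-id (lam M)    s       n≤k = cong lam (subst-scoped-id M s (s≤s n≤k))
subst-scoped-id (app M N)  (s , t) n≤k = cong₂ app (subst-scoped-id M s n≤k) (subst-scoped-id N t n≤k)
subst-scoped-id (pair M N) (s , t) n≤k = cong₂ pair (subst-scoped-id M s n≤k) (subst-scoped-id N t n≤k)
subst-scoped-id pi1 _ _ = refl
subst-scoped-id pi2 _ _ = refl
subst-scoped-id rec _ _ = refl
subst-scoped-id zer _ _ = refl
subst-scoped-id suk _ _ = refl
subst-scoped-id rnd _ _ = refl

subst-scoped : ∀ M {n k V} → Scoped (suc n) M → Scoped 0 V → k ℕ.≤ n → Scoped n (subst k V M)
subst-scoped (var i) {n} {k} {V} s v k≤n with ℕ.<-cmp i k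
... | tri< i<k _ _ rewrite subst-var-< V i<k = ℕ.<-≤-trans i<k k≤n
... | tri≈ _ i≡k _ rewrite subst-var-≡ V i≡k = Scoped-mono V z≤n v
subst-scoped (var (suc i)) {V = V} (s≤s s) v k≤n | tri> _ _ k<i rewrite subst-var-> V k<i = s
subst-scoped (lam M)    s       v k≤n = subst-scoped M s v (s≤s k≤n)
subst-scoped (app M N)  (s , t) v k≤n = subst-scoped M s v k≤n , subst-scoped N t v k≤n
subst-scoped (pair M N) (s , t) v k≤n = subst-scoped M s v k≤n , subst-scoped N t v k≤n
subst-scoped pi1 _ _ _ = tt
subst-scoped pi2 _ _ _ = tt
subst-scoped rec _ _ _ = tt
subst-scoped zer _ _ _ = tt
subst-scoped suk _ _ _ = tt
subst-scoped rnd _ _ _ = tt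

-- Closed values need no shifting under binders. Substituting at `k` first lowers the old variable
-- `suc k` to `k`, whence the change of index.
subst-comm : ∀ M {k V W} → Scoped 0 V → Scoped 0 W →
             subst k V (subst (suc k) W M) ≡ subst k W (subst k V M)
subst-comm (var i) {k} {V} {W} v w with ℕ.<-cmp i k
... | tri< i<k _ _
  rewrite subst-var-< W (ℕ.m≤n⇒m≤1+n i<k) | subst-var-< V i<k | subst-var-< W i<k = refl
... | tri≈ _ refl _
  rewrite subst-var-< W (ℕ.n<1+n k) | subst-var-≡ {k} V refl = sym (subst-scoped-id V v z≤n)
... | tri> _ _ k<i with ℕ.<-cmp i (suc k)
...   | tri< i<1+k _ _ = ⊥-elim (ℕ.<-irrefl refl (ℕ.<-≤-trans k<i (ℕ.s≤s⁻¹ i<1+k)))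
...   | tri≈ _ refl _
  rewrite subst-var-≡ {suc k} W refl | subst-var-> V k<i | subst-var-≡ {k} W refl = subst-scoped-id W w z≤n
...   | tri> _ _ (s≤s k<j)
  rewrite subst-var-> W (s≤s k<j) | subst-var-> V k<i | subst-var-> V k<j | subst-var-> W k<j = refl
subst-comm (lam M)    v w = cong lam (subst-comm M v w)
subst-comm (app M N)  v w = cong₂ app (subst-comm M v w) (subst-comm N v w)
subst-comm (pair M N) v w = cong₂ pair (subst-comm M v w) (subst-comm N v w)
subst-comm pi1 _ _ = refl
subst-comm pi2 _ _ = refl
subst-comm rec _ _ = refl
subst-comm zer _ _ = refl
subst-comm suk _ _ = refl
subst-comm rnd _ _ = refl

-- Each substitution lowers the later variables by one, so every entry of the list is substituted at
-- the same index `k`.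
close : ℕ → List Tm → Tm → Tm
close k []      M = M
close k (V ∷ γ) M = close k γ (subst k V M)

close-closed : ∀ γ {k M} → Scoped 0 M → close k γ M ≡ M
close-closed []      s = refl
close-closed (V ∷ γ) {k} {M} s rewrite subst-scoped-id M {k = k} {V = V} s z≤n = close-closed γ s

close-lam : ∀ γ {k M} → close k γ (lam M) ≡ lam (close (suc k) γ M)
close-lam []      = refl
close-lam (V ∷ γ) = close-lam γ

close-app : ∀ γ {k M N} → close k γ (app M N) ≡ app (close k γ M) (close k γ N)
close-app []      = refl
close-app (V ∷ γ) = close-app γ

close-pair : ∀ γ {k M N} → close k γ (pair M N) ≡ pair (close k γ M) (close k γ N)
close-pair []      = refl
close-pair (V ∷ γ) = close-pair γ

close-scoped : ∀ {γ} M → All (Scoped 0) γ → Scoped (length γ) M → Scoped 0 (close 0 γ M)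
close-scoped M []                s = s
close-scoped M (_∷_ {x = V} v c) s = close-scoped (subst 0 V M) c (subst-scoped M s v z≤n)

-- The right-hand side unfolds from `close k (V ∷ γ) M`, so contracting an abstraction closed by `γ`
-- amounts to extending the environment at its head.
subst-close : ∀ {γ k V} M → All (Scoped 0) γ → Scoped 0 V →
              subst k V (close (suc k) γ M) ≡ close k γ (subst k V M)
subst-close M [] v = refl
subst-close {W ∷ γ} {k} {V} M (w ∷ c) v =
  trans (subst-close (subst (suc k) W M) c v) (cong (close k γ) (subst-comm M v w))

-- Reduction in evaluation contexts

record EvalContext : Set where
  field
    plug     : Tm → Tm
    plug-det : ∀ {M M′} → step M ≡ det M′ → step (plug M) ≡ det (plug M′)
    plug-ran : ∀ {M g} → step M ≡ ran g → step (plug M) ≡ ran (λ n → plug (g n))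

open EvalContext

app-right : Tm → EvalContext
app-right M .plug N = app M N
app-right M .plug-det e rewrite e = refl
app-right M .plug-ran e rewrite e = refl

-- Arguments are evaluated before functions, so a hole in function position needs a value on its
-- right.
app-left : ∀ {V} → step V ≡ isVal → EvalContext
app-left {V} v .plug M = app M V
app-left v .plug-det e rewrite v | e = refl
app-left v .plug-ran e rewrite v | e = refl

pair-left : Tm → EvalContext
pair-left N .plug M = pair M N
pair-left N .plug-det e rewrite e = refl
pair-left N .plug-ran e rewrite e = refl

pair-right : ∀ {V} → step V ≡ isVal → EvalContext
pair-right {V} v .plug N = pair V N
pair-right v .plug-det e rewrite v | e = refl
pair-right v .plug-ran e rewrite v | e = refl

step-redex : ∀ V W → step V ≡ isVal → step W ≡ isVal → step (app V W) ≡ redex V W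
step-redex V W v w rewrite w | v = refl

step-pair : ∀ V W → step V ≡ isVal → step W ≡ isVal → step (pair V W) ≡ isVal
step-pair V W v w rewrite v | w = refl

step-num : ∀ n → step (num n) ≡ isVal
step-num zero    = refl
step-num (suc n) = step-redex suk (num n) refl (step-num n)

num-closed : ∀ n → Scoped 0 (num n)
num-closed zero    = tt
num-closed (suc n) = tt , num-closed n

num-injective : ∀ {m n} → num m ≡ num n → m ≡ n
num-injective {zero}  {zero}  _ = refl
num-injective {suc m} {suc n} e = cong suc (num-injective (suk-injective e))
  where
  suk-injective : ∀ {M N} → app suk M ≡ app suk N → M ≡ N
  suk-injective refl = refl

-- `step` is a function, and a numeral, being a value, has no `det` step.
⟶*-num-unique : ∀ {M m n} → M ⟶* num m → M ⟶* num n → m ≡ n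
⟶*-num-unique {m = m} {n} r s = num-injective (go r s (step-num m) (step-num n))
  where
  go : ∀ {M V W} → M ⟶* V → M ⟶* W → step V ≡ isVal → step W ≡ isVal → V ≡ W
  go done       done       v w = refl
  go done       (more e s) v w with () ← trans (sym v) e
  go (more e r) done       v w with () ← trans (sym w) e
  go (more e r) (more e′ s) v w with refl ← trans (sym e) e′ = go r s v w

-- Models of T^R and the fundamental theorem of the logical relation

Env : (Ty → Set) → List Ty → Set
Env D []      = ⊤
Env D (σ ∷ Γ) = D σ × Env D Γ

look : ∀ D {Γ i σ} → Γ ∋ i ∶ σ → Env D Γ → D σ
look D here      (d , ρ) = d
look D (there x) (d , ρ) = look D x ρ

-- `D` interprets values and `K` computations. The laws hold up to `≈`, which each model chooses:
-- the CPS model compares computations continuation by continuation, and so avoids function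
-- extensionality.
record Model : Set₁ where
  field
    D K      : Ty → Set
    natural  : ℕ → D nat
    function : ∀ {σ τ} → (D σ → K τ) → D (σ ⇒ τ)
    apply    : ∀ {σ τ} → D (σ ⇒ τ) → D σ → K τ
    couple   : ∀ {σ τ} → D σ → D τ → D (σ ⊗ τ)
    unit     : ∀ {τ} → D τ → K τ
    bind     : ∀ {σ τ} → K σ → (D σ → K τ) → K τ
    -- node ms samples n with probability 2^-(n+1) and continues as ms n
    node     : ∀ {τ} → (ℕ → K τ) → K τ
    _≈_      : ∀ {τ} → K τ → K τ → Set
    ≈-refl   : ∀ {τ} {m : K τ} → m ≈ m
    ≈-trans  : ∀ {τ} {m m′ m″ : K τ} → m ≈ m′ → m′ ≈ m″ → m ≈ m″
    bind-cong : ∀ {σ τ} {m m′ : K σ} {f : D σ → K τ} → m ≈ m′ → bind m f ≈ bind m′ f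
    bind-unit : ∀ {σ τ} {d : D σ} {f : D σ → K τ} → bind (unit d) f ≈ f d
    bind-node : ∀ {σ τ} {ms : ℕ → K σ} {f : D σ → K τ} →
                bind (node ms) f ≈ node (λ n → bind (ms n) f)
    apply-function : ∀ {σ τ} {f : D σ → K τ} {d} → apply (function f) d ≈ f d
    ⟦_⟧ : ∀ {Γ M τ} → Γ ⊢ M ∶ τ → Env D Γ → K τ
    fst    : ∀ {σ τ} → D ((σ ⊗ τ) ⇒ σ)
    snd    : ∀ {σ τ} → D ((σ ⊗ τ) ⇒ τ)
    succ   : D (nat ⇒ nat)
    iter   : ∀ {σ} → D ((σ ⊗ ((nat ⇒ σ ⇒ σ) ⊗ nat)) ⇒ σ)
    ⟦var⟧  : ∀ {Γ i σ} {x : Γ ∋ i ∶ σ} {ρ} → ⟦ ⊢var x ⟧ ρ ≈ unit (look D x ρ)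
    ⟦lam⟧  : ∀ {Γ M σ τ} {d : (σ ∷ Γ) ⊢ M ∶ τ} {ρ} →
             ⟦ ⊢lam d ⟧ ρ ≈ unit (function (λ a → ⟦ d ⟧ (a , ρ)))
    ⟦app⟧  : ∀ {Γ M N σ τ} {d : Γ ⊢ M ∶ (σ ⇒ τ)} {e : Γ ⊢ N ∶ σ} {ρ} →
             ⟦ ⊢app d e ⟧ ρ ≈ bind (⟦ e ⟧ ρ) (λ a → bind (⟦ d ⟧ ρ) (λ f → apply f a))
    ⟦pair⟧ : ∀ {Γ M N σ τ} {d : Γ ⊢ M ∶ σ} {e : Γ ⊢ N ∶ τ} {ρ} →
             ⟦ ⊢pair d e ⟧ ρ ≈ bind (⟦ d ⟧ ρ) (λ a → bind (⟦ e ⟧ ρ) (λ b → unit (couple a b)))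
    ⟦pi1⟧  : ∀ {Γ σ τ} {ρ : Env D Γ} → ⟦ ⊢pi1 {σ = σ} {τ} ⟧ ρ ≈ unit fst
    ⟦pi2⟧  : ∀ {Γ σ τ} {ρ : Env D Γ} → ⟦ ⊢pi2 {σ = σ} {τ} ⟧ ρ ≈ unit snd
    ⟦rec⟧  : ∀ {Γ σ} {ρ : Env D Γ} → ⟦ ⊢rec {σ = σ} ⟧ ρ ≈ unit iter
    ⟦zer⟧  : ∀ {Γ} {ρ : Env D Γ} → ⟦ ⊢zer ⟧ ρ ≈ unit (natural 0)
    ⟦suk⟧  : ∀ {Γ} {ρ : Env D Γ} → ⟦ ⊢suk ⟧ ρ ≈ unit succ
    ⟦rnd⟧  : ∀ {Γ} {ρ : Env D Γ} → ⟦ ⊢rnd ⟧ ρ ≈ node (λ n → unit (natural n))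
    apply-fst  : ∀ {σ τ} {a : D σ} {b : D τ} → apply fst (couple a b) ≈ unit a
    apply-snd  : ∀ {σ τ} {a : D σ} {b : D τ} → apply snd (couple a b) ≈ unit b
    apply-succ : ∀ {n} → apply succ (natural n) ≈ unit (natural (suc n))
    apply-iter-zero : ∀ {σ} {u : D σ} {v} → apply iter (couple u (couple v (natural 0))) ≈ unit u
    apply-iter-suc  : ∀ {σ} {u : D σ} {v n} →
      apply iter (couple u (couple v (natural (suc n)))) ≈
      bind (apply iter (couple u (couple v (natural n)))) (λ r →
        bind (apply v (natural n)) (λ g → apply g r))

module Fundamental (𝓜 : Model) where
  open Model 𝓜

  -- The well-founded, countably branching evaluation tree of a term, with matching denotations.
  data Comp {τ} (P : Tm → D τ → Set) : Tm → K τ → Set where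
    val : ∀ {M d m} → step M ≡ isVal → P M d → m ≈ unit d → Comp P M m
    det : ∀ {M M′ m} → step M ≡ det M′ → Comp P M′ m → Comp P M m
    ran : ∀ {M g m} {ms : ℕ → K τ} → step M ≡ ran g →
          (∀ n → Comp P (g n) (ms n)) → m ≈ node ms → Comp P M m

  -- Recursion on the type is possible because `Comp` takes the relation on values as a parameter.
  -- Closedness is built in at function types since only closed values may be substituted.
  R : (τ : Ty) → Tm → D τ → Set
  R nat     V d = ∃ λ n → V ≡ num n × d ≡ natural n
  R (σ ⇒ τ) V d = step V ≡ isVal × Scoped 0 V ×
    (∀ {W a} → R σ W a → Comp (R τ) (app V W) (apply d a))
  R (σ ⊗ τ) V d = ∃ λ V₁ → ∃ λ V₂ → ∃ λ a → ∃ λ b →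
    V ≡ pair V₁ V₂ × d ≡ couple a b × R σ V₁ a × R τ V₂ b

  R-val : ∀ τ {V d} → R τ V d → step V ≡ isVal
  R-val nat     (n , refl , _) = step-num n
  R-val (σ ⇒ τ) (v , _) = v
  R-val (σ ⊗ τ) (V₁ , V₂ , _ , _ , refl , _ , r , s) = step-pair V₁ V₂ (R-val σ r) (R-val τ s)

  R-closed : ∀ τ {V d} → R τ V d → Scoped 0 V
  R-closed nat     (n , refl , _) = num-closed n
  R-closed (σ ⇒ τ) (_ , c , _) = c
  R-closed (σ ⊗ τ) (_ , _ , _ , _ , refl , _ , r , s) = R-closed σ r , R-closed τ s

  Comp-≈ : ∀ {τ} {P : Tm → D τ → Set} {M m m′} → m′ ≈ m → Comp P M m → Comp P M m′
  Comp-≈ e (val s p e′) = val s p (≈-trans e e′)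
  Comp-≈ e (det s c)    = det s (Comp-≈ e c)
  Comp-≈ e (ran s c e′) = ran s c (≈-trans e e′)

  -- The tree of the plugged term is the tree of `M` with the trees of the plugged values grafted
  -- onto its leaves; `bind` is the same grafting on denotations.
  Comp-bind : ∀ {σ τ} {P : Tm → D σ → Set} {Q : Tm → D τ → Set} {M m f} (C : EvalContext) →
              Comp P M m → (∀ {V d} → step V ≡ isVal → P V d → Comp Q (plug C V) (f d)) →
              Comp Q (plug C M) (bind m f)
  Comp-bind C (val s p e) k = Comp-≈ (≈-trans (bind-cong e) bind-unit) (k s p)
  Comp-bind C (det s c)   k = det (plug-det C s) (Comp-bind C c k)
  Comp-bind C (ran s c e) k =
    ran (plug-ran C s) (λ n → Comp-bind C (c n) k) (≈-trans (bind-cong e) bind-node)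

  unit-R : ∀ τ {V d m} → R τ V d → m ≈ unit d → Comp (R τ) V m
  unit-R τ r e = val (R-val τ r) r e

  data EnvR : (Γ : List Ty) → List Tm → Env D Γ → Set where
    []  : EnvR [] [] tt
    _∷_ : ∀ {Γ γ ρ σ V d} → R σ V d → EnvR Γ γ ρ → EnvR (σ ∷ Γ) (V ∷ γ) (d , ρ)

  EnvR-closed : ∀ {Γ γ ρ} → EnvR Γ γ ρ → All (Scoped 0) γ
  EnvR-closed []      = []
  EnvR-closed (_∷_ {σ = σ} r rs) = R-closed σ r ∷ EnvR-closed rs

  EnvR-length : ∀ {Γ γ ρ} → EnvR Γ γ ρ → length Γ ≡ length γ
  EnvR-length []       = refl
  EnvR-length (r ∷ rs) = cong suc (EnvR-length rs)

  look-R : ∀ {Γ γ ρ i σ} (x : Γ ∋ i ∶ σ) → EnvR Γ γ ρ → R σ (close 0 γ (var i)) (look D x ρ)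
  look-R {σ = σ} here (_∷_ {γ = γ} {V = V} r rs) =
    transport (λ W → R σ W _) (sym (close-closed γ {0} {V} (R-closed σ r))) r
  look-R (there x) (r ∷ rs) = look-R x rs

  fst-R : ∀ {σ τ} → R ((σ ⊗ τ) ⇒ σ) pi1 fst
  fst-R {σ} {τ} = refl , tt , λ { (V , W , _ , _ , refl , refl , r , s) →
    det (step-redex pi1 (pair V W) refl (step-pair V W (R-val σ r) (R-val τ s))) (unit-R σ r apply-fst) }

  snd-R : ∀ {σ τ} → R ((σ ⊗ τ) ⇒ τ) pi2 snd
  snd-R {σ} {τ} = refl , tt , λ { (V , W , _ , _ , refl , refl , r , s) →
    det (step-redex pi2 (pair V W) refl (step-pair V W (R-val σ r) (R-val τ s))) (unit-R τ s apply-snd) }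

  succ-R : R (nat ⇒ nat) suk succ
  succ-R = refl , tt , λ { (n , refl , refl) → unit-R nat (suc n , refl , refl) apply-succ }

  iter-R : ∀ {σ} → R ((σ ⊗ ((nat ⇒ σ ⇒ σ) ⊗ nat)) ⇒ σ) rec iter
  iter-R {σ} = refl , tt , λ { (_ , _ , _ , _ , refl , refl , u ,
                                (_ , _ , _ , _ , refl , refl , v , (n , refl , refl))) → go u v n }
    where
    go : ∀ {U V a b} → R σ U a → R (nat ⇒ σ ⇒ σ) V b → ∀ n →
         Comp (R σ) (app rec (triple U V (num n))) (apply iter (couple a (couple b (natural n))))
    go-step : ∀ {U V a b} → R σ U a → R (nat ⇒ σ ⇒ σ) V b → ∀ n →
              step (app rec (triple U V (num n))) ≡ redex rec (triple U V (num n))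
    go-step {U} {V} u v n = step-redex rec (triple U V (num n)) refl
      (step-pair U (pair V (num n)) (R-val σ u)
        (step-pair V (num n) (R-val (nat ⇒ σ ⇒ σ) v) (step-num n)))
    go u v zero    = det (go-step u v 0) (unit-R σ u apply-iter-zero)
    -- The contractum is `V n` applied to the recursive call. The recursive call is the argument and
    -- runs first, then `V n`, then their application: the order of the binds in `apply-iter-suc`.
    go {U} {V} u v (suc n) = det (go-step u v (suc n)) (Comp-≈ apply-iter-suc
      (Comp-bind (app-right (app V (num n))) (go u v n) λ x-val x →
        Comp-bind (app-left x-val) (proj₂ (proj₂ v) (n , refl , refl)) λ _ g → proj₂ (proj₂ g) x))

  fundamental : ∀ {Γ γ ρ M τ} (d : Γ ⊢ M ∶ τ) → EnvR Γ γ ρ → Comp (R τ) (close 0 γ M) (⟦ d ⟧ ρ)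
  fundamental (⊢var {σ = σ} x) rs = unit-R σ (look-R x rs) ⟦var⟧
  fundamental {Γ} {γ} {ρ} {lam M} {σ ⇒ τ} (⊢lam d) rs
    rewrite close-lam γ {0} {M} = val refl (refl , closed , beta) ⟦lam⟧
    where
    closed : Scoped 0 (lam (close 1 γ M))
    closed = transport (Scoped 0) (close-lam γ) (close-scoped (lam M) (EnvR-closed rs)
               (transport (λ n → Scoped (suc n) M) (EnvR-length rs) (⊢-scoped d)))
    beta : ∀ {W a} → R σ W a →
           Comp (R τ) (app (lam (close 1 γ M)) W) (apply (function (λ b → ⟦ d ⟧ (b , ρ))) a)
    beta {W} r = det
      (trans (step-redex (lam (close 1 γ M)) W refl (R-val σ r))
             (cong det (subst-close M (EnvR-closed rs) (R-closed σ r))))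
      (Comp-≈ apply-function (fundamental d (r ∷ rs)))
  fundamental {γ = γ} {M = app M N} (⊢app d e) rs
    rewrite close-app γ {0} {M} {N} =
    Comp-≈ ⟦app⟧ (Comp-bind (app-right (close 0 γ M)) (fundamental e rs) λ w-val w →
      Comp-bind (app-left w-val) (fundamental d rs) λ _ f → proj₂ (proj₂ f) w)
  fundamental {γ = γ} {M = pair M N} {σ ⊗ τ} (⊢pair d e) rs
    rewrite close-pair γ {0} {M} {N} =
    Comp-≈ ⟦pair⟧ (Comp-bind (pair-left (close 0 γ N)) (fundamental d rs) λ v-val v →
      Comp-bind (pair-right v-val) (fundamental e rs) λ _ w →
        unit-R (σ ⊗ τ) (_ , _ , _ , _ , refl , refl , v , w) ≈-refl)
  fundamental {γ = γ} (⊢pi1 {σ} {τ}) rs rewrite close-closed γ {0} {pi1} tt =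
    unit-R ((σ ⊗ τ) ⇒ σ) fst-R ⟦pi1⟧
  fundamental {γ = γ} (⊢pi2 {σ} {τ}) rs rewrite close-closed γ {0} {pi2} tt =
    unit-R ((σ ⊗ τ) ⇒ τ) snd-R ⟦pi2⟧
  fundamental {γ = γ} (⊢rec {σ}) rs rewrite close-closed γ {0} {rec} tt =
    unit-R ((σ ⊗ ((nat ⇒ σ ⇒ σ) ⊗ nat)) ⇒ σ) iter-R ⟦rec⟧
  fundamental {γ = γ} ⊢zer rs rewrite close-closed γ {0} {zer} tt = unit-R nat (0 , refl , refl) ⟦zer⟧
  fundamental {γ = γ} ⊢suk rs rewrite close-closed γ {0} {suk} tt = unit-R (nat ⇒ nat) succ-R ⟦suk⟧
  fundamental {γ = γ} ⊢rnd rs rewrite close-closed γ {0} {rnd} tt =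
    ran refl (λ n → unit-R nat (n , refl , refl) ≈-refl) ⟦rnd⟧

  fundamental-closed : ∀ {M τ} (d : [] ⊢ M ∶ τ) → Comp (R τ) M (⟦ d ⟧ tt)
  fundamental-closed d = fundamental d []

  fundamental-num : ∀ {M τ} (d : [] ⊢ M ∶ (nat ⇒ τ)) n →
                    Comp (R τ) (app M (num n)) (bind (⟦ d ⟧ tt) (λ f → apply f (natural n)))
  fundamental-num d n =
    Comp-bind (app-left (step-num n)) (fundamental-closed d) λ _ f → proj₂ (proj₂ f) (n , refl , refl)

-- System T: standard semantics and adequacy

Std : Ty → Set
Std nat     = ℕ
Std (σ ⇒ τ) = Std σ → Std τ
Std (σ ⊗ τ) = Std σ × Std τ

primrec : {A : Set} → A → (ℕ → A → A) → ℕ → A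
primrec u v zero    = u
primrec u v (suc n) = v n (primrec u v n)

std : ∀ {Γ M τ} → Γ ⊢ M ∶ τ → Env Std Γ → Std τ
std (⊢var x)    ρ = look Std x ρ
std (⊢lam d)    ρ = λ a → std d (a , ρ)
std (⊢app d e)  ρ = std d ρ (std e ρ)
std (⊢pair d e) ρ = std d ρ , std e ρ
std ⊢pi1 ρ = proj₁
std ⊢pi2 ρ = proj₂
std ⊢rec ρ = λ (u , v , n) → primrec u v n
std ⊢zer ρ = 0
std ⊢suk ρ = suc
std ⊢rnd ρ = 0

-- R is read as always sampling 0; this is harmless, as R-free terms never sample.
stdModel : Model
stdModel = record
  { D = Std ; K = Std
  ; natural = λ n → n ; function = λ f → f ; apply = λ f → f ; couple = _,_
  ; unit = λ d → d ; bind = λ m f → f m ; node = λ ms → ms 0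
  ; _≈_ = _≡_ ; ≈-refl = refl ; ≈-trans = trans
  ; bind-cong = λ {_} {_} {_} {_} {f} → cong f ; bind-unit = refl ; bind-node = refl
  ; apply-function = refl
  ; ⟦_⟧ = std
  ; fst = proj₁ ; snd = proj₂ ; succ = suc ; iter = λ (u , v , n) → primrec u v n
  ; ⟦var⟧ = refl ; ⟦lam⟧ = refl ; ⟦app⟧ = refl ; ⟦pair⟧ = refl
  ; ⟦pi1⟧ = refl ; ⟦pi2⟧ = refl ; ⟦rec⟧ = refl ; ⟦zer⟧ = refl ; ⟦suk⟧ = refl ; ⟦rnd⟧ = refl
  ; apply-fst = refl ; apply-snd = refl ; apply-succ = refl
  ; apply-iter-zero = refl ; apply-iter-suc = refl
  }

-- Preservation of R-freeness under reduction

NoR-subst : ∀ M {k V} → NoR M → NoR V → NoR (subst k V M)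
NoR-subst (var i) {k} m v with ℕ.compare i k
... | ℕ.less _ _    = tt
... | ℕ.equal _     = v
... | ℕ.greater _ _ = tt
NoR-subst (lam M)    m       v = NoR-subst M m v
NoR-subst (app M N)  (m , n) v = NoR-subst M m v , NoR-subst N n v
NoR-subst (pair M N) (m , n) v = NoR-subst M m v , NoR-subst N n v
NoR-subst pi1 _ _ = tt
NoR-subst pi2 _ _ = tt
NoR-subst rec _ _ = tt
NoR-subst zer _ _ = tt
NoR-subst suk _ _ = tt
NoR-subst rnd () _

-- Joins two facts in one predicate: R-freeness survives a step, and an R-free term never samples.
NoRStep : Step → Set
NoRStep isVal   = ⊤
NoRStep (det M) = NoR M
NoRStep (ran g) = ⊥
NoRStep stuck   = ⊤

-- The catch-all clause of `redex` computes only once its arguments are split, whence the many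
-- trivial cases.
NoR-redex : ∀ M V → NoR M → NoR V → NoRStep (redex M V)
NoR-redex (lam M) V m v = NoR-subst M m v
NoR-redex pi1 (pair V W) m (v , w) = v
NoR-redex pi2 (pair V W) m (v , w) = w
NoR-redex rec (pair U (pair V zer)) m (u , v , n) = u
NoR-redex rec (pair U (pair V (app suk W))) m (u , v , _ , n) = (v , n) , (tt , u , v , n)
NoR-redex suk V m v = tt
NoR-redex (var _) V m v = tt
NoR-redex (app _ _) V m v = tt
NoR-redex (pair _ _) V m v = tt
NoR-redex zer V m v = tt
NoR-redex pi1 (var _) m v = tt
NoR-redex pi1 (lam _) m v = tt
NoR-redex pi1 (app _ _) m v = tt
NoR-redex pi1 pi1 m v = tt
NoR-redex pi1 pi2 m v = tt
NoR-redex pi1 rec m v = tt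
NoR-redex pi1 zer m v = tt
NoR-redex pi1 suk m v = tt
NoR-redex pi2 (var _) m v = tt
NoR-redex pi2 (lam _) m v = tt
NoR-redex pi2 (app _ _) m v = tt
NoR-redex pi2 pi1 m v = tt
NoR-redex pi2 pi2 m v = tt
NoR-redex pi2 rec m v = tt
NoR-redex pi2 zer m v = tt
NoR-redex pi2 suk m v = tt
NoR-redex rec (var _) m v = tt
NoR-redex rec (lam _) m v = tt
NoR-redex rec (app _ _) m v = tt
NoR-redex rec pi1 m v = tt
NoR-redex rec pi2 m v = tt
NoR-redex rec rec m v = tt
NoR-redex rec zer m v = tt
NoR-redex rec suk m v = tt
NoR-redex rec (pair U (var _)) m v = tt
NoR-redex rec (pair U (lam _)) m v = tt
NoR-redex rec (pair U (app _ _)) m v = tt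
NoR-redex rec (pair U pi1) m v = tt
NoR-redex rec (pair U pi2) m v = tt
NoR-redex rec (pair U rec) m v = tt
NoR-redex rec (pair U zer) m v = tt
NoR-redex rec (pair U suk) m v = tt
NoR-redex rec (pair U (pair V (var _))) m v = tt
NoR-redex rec (pair U (pair V (lam _))) m v = tt
NoR-redex rec (pair U (pair V (pair _ _))) m v = tt
NoR-redex rec (pair U (pair V pi1)) m v = tt
NoR-redex rec (pair U (pair V pi2)) m v = tt
NoR-redex rec (pair U (pair V rec)) m v = tt
NoR-redex rec (pair U (pair V suk)) m v = tt
NoR-redex rec (pair U (pair V (app (var _) _))) m v = tt
NoR-redex rec (pair U (pair V (app (lam _) _))) m v = tt
NoR-redex rec (pair U (pair V (app (app _ _) _))) m v = tt
NoR-redex rec (pair U (pair V (app (pair _ _) _))) m v = tt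
NoR-redex rec (pair U (pair V (app pi1 _))) m v = tt
NoR-redex rec (pair U (pair V (app pi2 _))) m v = tt
NoR-redex rec (pair U (pair V (app rec _))) m v = tt
NoR-redex rec (pair U (pair V (app zer _))) m v = tt

NoR-step : ∀ M → NoR M → NoRStep (step M)
NoR-step (var _) _ = tt
NoR-step (lam M) _ = tt
NoR-step (app M N) (m , n) with step N | NoR-step N n
... | det N′ | n′ = m , n′
... | ran g  | ()
... | stuck  | _  = tt
... | isVal  | _  with step M | NoR-step M m
...   | det M′ | m′ = m′ , n
...   | ran g  | ()
...   | stuck  | _  = tt
...   | isVal  | _  = NoR-redex M N m n
NoR-step (pair M N) (m , n) with step M | NoR-step M m
... | det M′ | m′ = m′ , n
... | ran g  | ()
... | stuck  | _  = tt
... | isVal  | _  with step N | NoR-step N n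
...   | det N′ | n′ = m , n′
...   | ran g  | ()
...   | stuck  | _  = tt
...   | isVal  | _  = tt
NoR-step pi1 _ = tt
NoR-step pi2 _ = tt
NoR-step rec _ = tt
NoR-step zer _ = tt
NoR-step suk _ = tt
NoR-step rnd ()

module Adequacy where
  open Fundamental stdModel

  -- Without sampling nodes the evaluation tree is a single path, and that path is a reduction
  -- sequence.
  Comp-⟶* : ∀ {M n} → NoR M → Comp (R nat) M n → M ⟶* num n
  Comp-⟶* r (val s (n , refl , refl) refl) = done
  Comp-⟶* {M} r (det s c) = more s (Comp-⟶* (transport NoRStep s (NoR-step M r)) c)
  Comp-⟶* {M} r (ran s c e) = ⊥-elim (transport NoRStep s (NoR-step M r))

  NoR-num : ∀ n → NoR (num n)
  NoR-num zero    = tt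
  NoR-num (suc n) = tt , NoR-num n

  adequacy : ∀ {M} (d : [] ⊢ M ∶ (nat ⇒ nat)) → NoR M → ∀ n → app M (num n) ⟶* num (std d tt n)
  adequacy d r n = Comp-⟶* (r , NoR-num n) (fundamental-num d n)

-- Combinators for typed R-free terms

record Term (Γ : List Ty) (τ : Ty) : Set where
  constructor term
  field
    {raw}  : Tm
    typing : Γ ⊢ raw ∶ τ
    noR    : NoR raw

open Term

infixl 9 _·_
infix  4 ƛ_

ƛ_ : ∀ {Γ σ τ} → Term (σ ∷ Γ) τ → Term Γ (σ ⇒ τ)
ƛ term d r = term (⊢lam d) r

_·_ : ∀ {Γ σ τ} → Term Γ (σ ⇒ τ) → Term Γ σ → Term Γ τ
term d r · term e s = term (⊢app d e) (r , s)

⟨_,_⟩ : ∀ {Γ σ τ} → Term Γ σ → Term Γ τ → Term Γ (σ ⊗ τ)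
⟨ term d r , term e s ⟩ = term (⊢pair d e) (r , s)

π₁ : ∀ {Γ σ τ} → Term Γ (σ ⊗ τ) → Term Γ σ
π₁ t = term ⊢pi1 tt · t

π₂ : ∀ {Γ σ τ} → Term Γ (σ ⊗ τ) → Term Γ τ
π₂ t = term ⊢pi2 tt · t

recursor : ∀ {Γ σ} → Term Γ σ → Term Γ (nat ⇒ σ ⇒ σ) → Term Γ nat → Term Γ σ
recursor u v n = term ⊢rec tt · ⟨ u , ⟨ v , n ⟩ ⟩

zeroᵗ : ∀ {Γ} → Term Γ nat
zeroᵗ = term ⊢zer tt

sucᵗ : ∀ {Γ} → Term Γ nat → Term Γ nat
sucᵗ t = term ⊢suk tt · t

v0 : ∀ {Γ σ} → Term (σ ∷ Γ) σ
v0 = term (⊢var here) tt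

v1 : ∀ {Γ σ τ} → Term (τ ∷ σ ∷ Γ) σ
v1 = term (⊢var (there here)) tt

v2 : ∀ {Γ σ τ υ} → Term (υ ∷ τ ∷ σ ∷ Γ) σ
v2 = term (⊢var (there (there here))) tt

v3 : ∀ {Γ σ τ υ φ} → Term (φ ∷ υ ∷ τ ∷ σ ∷ Γ) σ
v3 = term (⊢var (there (there (there here)))) tt

v4 : ∀ {Γ σ τ υ φ ψ} → Term (ψ ∷ φ ∷ υ ∷ τ ∷ σ ∷ Γ) σ
v4 = term (⊢var (there (there (there (there here))))) tt

eval : ∀ {Γ τ} → Term Γ τ → Env Std Γ → Std τ
eval t = std (typing t)

-- Arithmetic in System T

addᵗ : ∀ {Γ} → Term Γ (nat ⇒ nat ⇒ nat)
addᵗ = ƛ ƛ recursor v0 (ƛ ƛ sucᵗ v0) v1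

mulᵗ : ∀ {Γ} → Term Γ (nat ⇒ nat ⇒ nat)
mulᵗ = ƛ ƛ recursor zeroᵗ (ƛ ƛ addᵗ · v2 · v0) v1

-- The inner `recursor` is the predecessor: it returns the index of its last step.
monusᵗ : ∀ {Γ} → Term Γ (nat ⇒ nat ⇒ nat)
monusᵗ = ƛ ƛ recursor v1 (ƛ ƛ recursor zeroᵗ (ƛ ƛ v1) v0) v0

ifZeroᵗ : ∀ {Γ} → Term Γ nat → Term Γ (nat ⇒ nat ⇒ nat)
ifZeroᵗ t = (ƛ ƛ ƛ recursor v1 (ƛ ƛ v2) v2) · t

plus times monus : ℕ → ℕ → ℕ
plus  = eval {[]} addᵗ tt
times = eval {[]} mulᵗ tt
monus = eval {[]} monusᵗ tt

ifZero : ℕ → ℕ → ℕ → ℕ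
ifZero c a b = primrec a (λ _ _ → b) c

plus-correct : ∀ m n → plus m n ≡ m ℕ.+ n
plus-correct zero    n = refl
plus-correct (suc m) n = cong suc (plus-correct m n)

times-correct : ∀ m n → times m n ≡ m ℕ.* n
times-correct zero    n = refl
times-correct (suc m) n = trans (plus-correct n (times m n)) (cong (n ℕ.+_) (times-correct m n))

monus-correct : ∀ m n → monus m n ≡ m ℕ.∸ n
monus-correct m zero    = refl
monus-correct m (suc n) = begin
  primrec 0 (λ k _ → k) (monus m n) ≡⟨ pred-correct (monus m n) ⟩
  ℕ.pred (monus m n)                ≡⟨ cong ℕ.pred (monus-correct m n) ⟩
  ℕ.pred (m ℕ.∸ n)                  ≡⟨ ℕ.pred[m∸n]≡m∸[1+n] m n ⟩
  m ℕ.∸ suc n                       ∎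
  where
  open ≡-Reasoning
  pred-correct : ∀ k → primrec 0 (λ k _ → k) k ≡ ℕ.pred k
  pred-correct zero    = refl
  pred-correct (suc k) = refl

-- Scaled subdistributions: (N , w) stands for the subdistribution v ↦ w v / N

Weights : Ty
Weights = nat ⊗ (nat ⇒ nat)

-- The argument is the precision.
Answer : Ty
Answer = nat ⇒ Weights

-- The even mixture of `u / M` and `w / N` over the common denominator `2MN`, with numerators
-- `uN + wM`; no division takes place.
mixᵗ : ∀ {Γ} → Term Γ (Weights ⇒ Weights ⇒ Weights)
mixᵗ = ƛ ƛ ⟨ (ƛ addᵗ · v0 · v0) · (mulᵗ · π₁ v1 · π₁ v0)
           , (ƛ addᵗ · (mulᵗ · (π₂ v2 · v0) · π₁ v1) · (mulᵗ · (π₂ v1 · v0) · π₁ v2)) ⟩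

-- The sum over `j < n` of `2^-(j+1)` times the `j`-th subdistribution, in Horner form. The
-- recursion produces a function of the sequence, so that the recursive call can receive the shifted
-- sequence; it ends in the zero subdistribution.
mixturesᵗ : ∀ {Γ} → Term Γ (nat ⇒ (nat ⇒ Weights) ⇒ Weights)
mixturesᵗ = ƛ recursor (ƛ ⟨ sucᵗ zeroᵗ , ƛ zeroᵗ ⟩)
                       (ƛ ƛ ƛ mixᵗ · (v0 · zeroᵗ) · (v1 · (ƛ v1 · sucᵗ v0)))
                       v0

-- The point mass at `n`, the same at every precision. Its denominator is `n + 1`, so that every
-- outcome of nonzero weight lies below the denominator; mixing keeps this invariant, which bounds
-- the search in `majorityᵗ`.
pointᵗ : ∀ {Γ} → Term Γ (nat ⇒ Answer)
pointᵗ = ƛ ƛ ⟨ sucᵗ v1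
             , (ƛ ifZeroᵗ (addᵗ · (monusᵗ · v2 · v0) · (monusᵗ · v0 · v2)) · sucᵗ v2 · zeroᵗ) ⟩

-- Searches downwards from the denominator `N`. The difference of `N + 1` and twice a weight
-- truncates to zero exactly when that weight exceeds half of `N`; `0` is the default.
majorityᵗ : ∀ {Γ} → Term Γ (Weights ⇒ nat)
majorityᵗ = ƛ recursor zeroᵗ
  (ƛ ƛ ifZeroᵗ (monusᵗ · sucᵗ (π₁ v2) · (addᵗ · (π₂ v2 · v1) · (π₂ v2 · v1))) · v1 · v0)
  (π₁ v0)

-- The continuation-passing translation of T^R into System T

Cps : Ty → Ty
Cps τ = (τ ⇒ Answer) ⇒ Answer

-- Types of values in the call-by-value CPS translation; computations have type `Cps (τ ᶜ)`.
_ᶜ : Ty → Ty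
nat ᶜ     = nat
(σ ⇒ τ) ᶜ = σ ᶜ ⇒ Cps (τ ᶜ)
(σ ⊗ τ) ᶜ = σ ᶜ ⊗ τ ᶜ

∋-ᶜ : ∀ {Γ i σ} → Γ ∋ i ∶ σ → map _ᶜ Γ ∋ i ∶ (σ ᶜ)
∋-ᶜ here      = here
∋-ᶜ (there x) = there (∋-ᶜ x)

unitᵗ : ∀ {Γ σ} → Term Γ (σ ⇒ Cps σ)
unitᵗ = ƛ ƛ v0 · v1

appᵗ : ∀ {Γ σ τ} → Term Γ (Cps (σ ⇒ Cps τ) ⇒ Cps σ ⇒ Cps τ)
appᵗ = ƛ ƛ ƛ v1 · (ƛ v3 · (ƛ v0 · v1 · v2))

pairᵗ : ∀ {Γ σ τ} → Term Γ (Cps σ ⇒ Cps τ ⇒ Cps (σ ⊗ τ))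
pairᵗ = ƛ ƛ ƛ v2 · (ƛ v2 · (ƛ v2 · ⟨ v1 , v0 ⟩))

-- Recursion at the type of computations: each step first runs the computation of the recursive call
-- and then applies the step function to its value.
recᵗ : ∀ {Γ σ} → Term Γ ((σ ⊗ ((nat ⇒ Cps (σ ⇒ Cps σ)) ⊗ nat)) ⇒ Cps σ)
recᵗ = ƛ recursor (unitᵗ · π₁ v0)
                  (ƛ ƛ ƛ v1 · (ƛ π₁ (π₂ v4) · v3 · (ƛ v0 · v1 · v2)))
                  (π₂ (π₂ v0))

-- The s-th approximation samples only from {0, …, s} and passes precision s + 1 on, so the
-- mass lost along all samples of a run is at most 2^-(s+1) + 2^-(s+2) + … = 2^-s.
sampleᵗ : ∀ {Γ} → Term Γ (Cps nat)
sampleᵗ = ƛ ƛ mixturesᵗ · sucᵗ v0 · (ƛ v2 · v0 · sucᵗ v1)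

translate : ∀ {Γ M τ} → Γ ⊢ M ∶ τ → Term (map _ᶜ Γ) (Cps (τ ᶜ))
translate (⊢var x)    = unitᵗ · term (⊢var (∋-ᶜ x)) tt
translate (⊢lam d)    = unitᵗ · (ƛ translate d)
translate (⊢app d e)  = appᵗ · translate d · translate e
translate (⊢pair d e) = pairᵗ · translate d · translate e
translate ⊢pi1        = unitᵗ · (ƛ unitᵗ · π₁ v0)
translate ⊢pi2        = unitᵗ · (ƛ unitᵗ · π₂ v0)
translate ⊢rec        = unitᵗ · recᵗ
translate ⊢zer        = unitᵗ · zeroᵗ
translate ⊢suk        = unitᵗ · (ƛ unitᵗ · sucᵗ v0)
translate ⊢rnd        = sampleᵗ

mixtures : ℕ → (ℕ → Std Weights) → Std Weights
mixtures = eval {[]} mixturesᵗ tt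

CpsD CpsK : Ty → Set
CpsD τ = Std (τ ᶜ)
CpsK τ = Std (Cps (τ ᶜ))

env-ᶜ : ∀ {Γ} → Env CpsD Γ → Env Std (map _ᶜ Γ)
env-ᶜ {[]}    tt      = tt
env-ᶜ {σ ∷ Γ} (d , ρ) = d , env-ᶜ ρ

look-ᶜ : ∀ {Γ i σ} (x : Γ ∋ i ∶ σ) ρ → look Std (∋-ᶜ x) (env-ᶜ ρ) ≡ look CpsD x ρ
look-ᶜ here      (d , ρ) = refl
look-ᶜ (there x) (d , ρ) = look-ᶜ x ρ

-- The translation followed by the standard model of System T. Continuation passing turns the monad
-- laws into definitional equalities; variables need `look-ᶜ`, since translating an environment
-- commutes with lookup only by induction.
cpsModel : Model
cpsModel = record
  { D = CpsD ; K = CpsK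
  ; natural = λ n → n ; function = λ f → f ; apply = λ f → f ; couple = _,_
  ; unit = λ d k → k d ; bind = λ m f k → m (λ d → f d k)
  ; node = λ ms k s → mixtures (suc s) (λ j → ms j k (suc s))
  ; _≈_ = λ m m′ → ∀ k → m k ≡ m′ k
  ; ≈-refl = λ _ → refl ; ≈-trans = λ p q k → trans (p k) (q k)
  ; bind-cong = λ p k → p _ ; bind-unit = λ _ → refl ; bind-node = λ _ → refl
  ; apply-function = λ _ → refl
  ; ⟦_⟧ = λ d ρ → eval (translate d) (env-ᶜ ρ)
  ; fst = λ (a , _) k → k a ; snd = λ (_ , b) k → k b ; succ = λ n k → k (suc n)
  ; iter = eval {[]} recᵗ tt
  ; ⟦var⟧ = λ {_} {_} {_} {x} {ρ} k → cong k (look-ᶜ x ρ)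
  ; ⟦lam⟧ = λ _ → refl ; ⟦app⟧ = λ _ → refl ; ⟦pair⟧ = λ _ → refl
  ; ⟦pi1⟧ = λ _ → refl ; ⟦pi2⟧ = λ _ → refl ; ⟦rec⟧ = λ _ → refl
  ; ⟦zer⟧ = λ _ → refl ; ⟦suk⟧ = λ _ → refl ; ⟦rnd⟧ = λ _ → refl
  ; apply-fst = λ _ → refl ; apply-snd = λ _ → refl ; apply-succ = λ _ → refl
  ; apply-iter-zero = λ _ → refl ; apply-iter-suc = λ _ → refl
  }

-- The arguments are the translated program, the bound `h` and the input `n`. The final continuation
-- is the point mass, and the precision is `h n`.
majorityOutputᵗ : ∀ {Γ} → Term Γ (Cps ((nat ⇒ nat) ᶜ) ⇒ (nat ⇒ nat) ⇒ nat ⇒ nat)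
majorityOutputᵗ = ƛ ƛ ƛ majorityᵗ · (v2 · (ƛ v0 · v1 · pointᵗ) · (v1 · v0))

-- Rational arithmetic

-- Keeps the normalising fraction `+ n / 1` from unfolding; later arguments rely on the facts of
-- this block.
opaque
  fromℕ : ℕ → ℚ
  fromℕ n = + n / 1

  fromℕ-0 : fromℕ 0 ≡ 0ℚ
  fromℕ-0 = refl

  fromℕ-1 : fromℕ 1 ≡ 1ℚ
  fromℕ-1 = refl

  toℚᵘ-fromℕ : ∀ n → toℚᵘ (fromℕ n) ℚᵘ.≃ ℚᵘ.mkℚᵘ (+ n) 0
  toℚᵘ-fromℕ n = ℚ.toℚᵘ-fromℚᵘ (ℚᵘ.mkℚᵘ (+ n) 0)

  fromℕ-nonNeg : ∀ n → NonNegative (fromℕ n)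
  fromℕ-nonNeg n = ℚ.normalize-nonNeg n 1

  fromℕ-pos : ∀ {n} → 0 ℕ.< n → Positive (fromℕ n)
  fromℕ-pos {suc n} _ = ℚ.normalize-pos (suc n) 1

fromℕ-+ : ∀ m n → fromℕ (m ℕ.+ n) ≡ fromℕ m + fromℕ n
fromℕ-+ m n = ℚ.toℚᵘ-injective (begin
  toℚᵘ (fromℕ (m ℕ.+ n))                   ≈⟨ toℚᵘ-fromℕ (m ℕ.+ n) ⟩
  ℚᵘ.mkℚᵘ (+ (m ℕ.+ n)) 0                  ≈⟨ ℚᵘ.*≡* (cong (ℤ._* + 1)
       (sym (cong₂ ℤ._+_ (ℤ.*-identityʳ (+ m)) (ℤ.*-identityʳ (+ n))))) ⟩
  ℚᵘ.mkℚᵘ (+ m) 0 ℚᵘ.+ ℚᵘ.mkℚᵘ (+ n) 0     ≈⟨ ℚᵘ.+-cong (toℚᵘ-fromℕ m) (toℚᵘ-fromℕ n) ⟨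
  toℚᵘ (fromℕ m) ℚᵘ.+ toℚᵘ (fromℕ n)       ≈⟨ ℚ.toℚᵘ-homo-+ (fromℕ m) (fromℕ n) ⟨
  toℚᵘ (fromℕ m + fromℕ n)                 ∎)
  where open ℚᵘ.≃-Reasoning

fromℕ-* : ∀ m n → fromℕ (m ℕ.* n) ≡ fromℕ m * fromℕ n
fromℕ-* m n = ℚ.toℚᵘ-injective (begin
  toℚᵘ (fromℕ (m ℕ.* n))                   ≈⟨ toℚᵘ-fromℕ (m ℕ.* n) ⟩
  ℚᵘ.mkℚᵘ (+ (m ℕ.* n)) 0                  ≈⟨ ℚᵘ.*≡* (cong (ℤ._* + 1) (ℤ.pos-* m n)) ⟩
  ℚᵘ.mkℚᵘ (+ m) 0 ℚᵘ.* ℚᵘ.mkℚᵘ (+ n) 0     ≈⟨ ℚᵘ.*-cong (toℚᵘ-fromℕ m) (toℚᵘ-fromℕ n) ⟨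
  toℚᵘ (fromℕ m) ℚᵘ.* toℚᵘ (fromℕ n)       ≈⟨ ℚ.toℚᵘ-homo-* (fromℕ m) (fromℕ n) ⟨
  toℚᵘ (fromℕ m * fromℕ n)                 ∎)
  where open ℚᵘ.≃-Reasoning

recip-inverse : ∀ m → recip (suc m) * fromℕ (suc m) ≡ 1ℚ
recip-inverse m = ℚ.toℚᵘ-injective (begin
  toℚᵘ (recip (suc m) * fromℕ (suc m))             ≈⟨ ℚ.toℚᵘ-homo-* (recip (suc m)) (fromℕ (suc m)) ⟩
  toℚᵘ (recip (suc m)) ℚᵘ.* toℚᵘ (fromℕ (suc m))   ≈⟨ ℚᵘ.*-cong
       (ℚ.toℚᵘ-fromℚᵘ (ℚᵘ.mkℚᵘ (+ 1) m)) (toℚᵘ-fromℕ (suc m)) ⟩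
  ℚᵘ.mkℚᵘ (+ 1) m ℚᵘ.* ℚᵘ.mkℚᵘ (+ suc m) 0         ≈⟨ ℚᵘ.*-comm (ℚᵘ.mkℚᵘ (+ 1) m) (ℚᵘ.mkℚᵘ (+ suc m) 0) ⟩
  ℚᵘ.mkℚᵘ (+ suc m) 0 ℚᵘ.* ℚᵘ.mkℚᵘ (+ 1) m         ≈⟨ ℚᵘ.*≡* (trans
       (trans (ℤ.*-identityʳ (+ suc m ℤ.* + 1)) (ℤ.*-identityʳ (+ suc m)))
       (sym (trans (ℤ.*-identityˡ (+ (suc m ℕ.+ 0))) (cong (+_ ∘ suc) (ℕ.+-identityʳ m))))) ⟩
  toℚᵘ 1ℚ                                          ∎)
  where open ℚᵘ.≃-Reasoning

fromℕ-≥0 : ∀ n → 0ℚ ≤ fromℕ n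
fromℕ-≥0 n = ℚ.nonNegative⁻¹ (fromℕ n) {{fromℕ-nonNeg n}}

fromℕ-mono : ∀ {m n} → m ℕ.≤ n → fromℕ m ≤ fromℕ n
fromℕ-mono {m} {n} m≤n = begin
  fromℕ m                      ≡⟨ ℚ.+-identityʳ (fromℕ m) ⟨
  fromℕ m + 0ℚ                 ≤⟨ ℚ.+-monoʳ-≤ (fromℕ m) (fromℕ-≥0 (n ℕ.∸ m)) ⟩
  fromℕ m + fromℕ (n ℕ.∸ m)    ≡⟨ fromℕ-+ m (n ℕ.∸ m) ⟨
  fromℕ (m ℕ.+ (n ℕ.∸ m))      ≡⟨ cong fromℕ (ℕ.m+[n∸m]≡n m≤n) ⟩
  fromℕ n                      ∎
  where open ℚ.≤-Reasoning

halve-mono : ∀ {p q} → p ≤ q → ½ * p ≤ ½ * q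
halve-mono = ℚ.*-monoˡ-≤-nonNeg ½

halves : ∀ p → ½ * p + ½ * p ≡ p
halves = solve 1 (λ p → con ½ :* p :+ con ½ :* p := p) refl

power : ℕ → ℚ
power zero    = 1ℚ
power (suc s) = ½ * power s

power-≥0 : ∀ s → 0ℚ ≤ power s
power-≥0 zero    = ℚ.nonNegative⁻¹ 1ℚ
power-≥0 (suc s) = halve-mono (power-≥0 s)

power-≤1 : ∀ s → power s ≤ 1ℚ
power-≤1 zero    = ℚ.≤-refl
power-≤1 (suc s) = ℚ.≤-trans (halve-mono (power-≤1 s)) (from-yes (½ * 1ℚ ℚ.≤? 1ℚ))

-- This is `s ≤ 2^s`. In the step, `2^-(s+1) (s+1)` is the average of `2^-s` and `2^-s s`, both at
-- most one.
power-*-≤1 : ∀ s → power s * fromℕ s ≤ 1ℚ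
power-*-≤1 zero    rewrite fromℕ-0 = from-yes (1ℚ * 0ℚ ℚ.≤? 1ℚ)
power-*-≤1 (suc s) = begin
  ½ * power s * fromℕ (suc s)                 ≡⟨ cong (_*_ (½ * power s))
                                                     (trans (fromℕ-+ 1 s) (cong (_+ fromℕ s) fromℕ-1)) ⟩
  ½ * power s * (1ℚ + fromℕ s)                ≡⟨ solve 2 (λ p n → con ½ :* p :* (con 1ℚ :+ n) := con ½ :* (p :+ p :* n)) refl
                                                     (power s) (fromℕ s) ⟩
  ½ * (power s + power s * fromℕ s)           ≤⟨ halve-mono (ℚ.+-mono-≤ (power-≤1 s) (power-*-≤1 s)) ⟩
  ½ * (1ℚ + 1ℚ)                               ≡⟨⟩
  1ℚ                                          ∎
  where open ℚ.≤-Reasoning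

power-≤-recip : ∀ {m} → m ≢ 0 → power m ≤ recip m
power-≤-recip {zero}  m≢0 = ⊥-elim (m≢0 refl)
power-≤-recip {suc m} m≢0 = ℚ.*-cancelʳ-≤-pos (fromℕ (suc m)) {{fromℕ-pos (s≤s z≤n)}}
  (ℚ.≤-trans (power-*-≤1 (suc m)) (ℚ.≤-reflexive (sym (recip-inverse m))))

-- geo n x = Σ_{j<n} 2^-(j+1) x j, in Horner form
geo : ℕ → (ℕ → ℚ) → ℚ
geo zero    x = 0ℚ
geo (suc n) x = ½ * (x 0 + geo n (x ∘ suc))

geo-cong : ∀ n {x y} → (∀ j → x j ≡ y j) → geo n x ≡ geo n y
geo-cong zero    e = refl
geo-cong (suc n) e = cong (½ *_) (cong₂ _+_ (e 0) (geo-cong n (e ∘ suc)))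

geo-≥0 : ∀ n {x} → (∀ j → 0ℚ ≤ x j) → 0ℚ ≤ geo n x
geo-≥0 zero    p = ℚ.≤-refl
geo-≥0 (suc n) p = halve-mono (ℚ.+-mono-≤ (p 0) (geo-≥0 n (p ∘ suc)))

geo-≤1 : ∀ n {x} → (∀ j → x j ≤ 1ℚ) → geo n x ≤ 1ℚ
geo-≤1 zero    p = ℚ.nonNegative⁻¹ 1ℚ
geo-≤1 (suc n) p = halve-mono (ℚ.+-mono-≤ (p 0) (geo-≤1 n (p ∘ suc)))

-- The coefficients from index `s` onwards add up to at most `2^-s`, and every entry is at most one.
geo-tail : ∀ n s {x} → (∀ j → 0ℚ ≤ x j) → (∀ j → x j ≤ 1ℚ) → geo n x ≤ geo s x + power s
geo-tail zero    s       p q = ℚ.+-mono-≤ (geo-≥0 s p) (power-≥0 s)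
geo-tail (suc n) zero    p q = geo-≤1 (suc n) q
geo-tail (suc n) (suc s) {x} p q = begin
  ½ * (x 0 + geo n (x ∘ suc))                 ≤⟨ halve-mono (ℚ.+-monoʳ-≤ (x 0) (geo-tail n s (p ∘ suc) (q ∘ suc))) ⟩
  ½ * (x 0 + (geo s (x ∘ suc) + power s))     ≡⟨ solve 4 (λ h a b c → h :* (a :+ (b :+ c)) := h :* (a :+ b) :+ h :* c) refl
                                                      ½ (x 0) (geo s (x ∘ suc)) (power s) ⟩
  ½ * (x 0 + geo s (x ∘ suc)) + ½ * power s   ∎
  where open ℚ.≤-Reasoning

-- The coefficients add up to at most one, so lowering every entry by `e` lowers the sum by at most
-- `e`.
geo-shift : ∀ n {x e} → 0ℚ ≤ e → geo n x - e ≤ geo n (λ j → x j - e)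
geo-shift zero    {x} {e} p = ℚ.≤-trans (ℚ.≤-reflexive (ℚ.+-identityˡ (- e))) (ℚ.neg-antimono-≤ p)
geo-shift (suc n) {x} {e} p = begin
  ½ * (x 0 + geo n (x ∘ suc)) - e                    ≡⟨ solve 3 (λ a b c → con ½ :* (a :+ b) :- c
                                                                         := con ½ :* ((a :- c) :+ (b :- c))) refl
                                                             (x 0) (geo n (x ∘ suc)) e ⟩
  ½ * ((x 0 - e) + (geo n (x ∘ suc) - e))            ≤⟨ halve-mono (ℚ.+-monoʳ-≤ (x 0 - e) (geo-shift n p)) ⟩
  ½ * ((x 0 - e) + geo n (λ j → x (suc j) - e))      ∎
  where open ℚ.≤-Reasoning

-- The mass of an outcome, computed from the first step of the run

expect : (Tm → ℚ) → Dist → ℚ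
expect φ = foldr (λ (w , M) acc → w * φ M + acc) 0ℚ

afterStep : ℕ → (Tm → ℚ) → Tm → Step → ℚ
afterStep Nc φ M isVal    = φ M
afterStep Nc φ M stuck    = φ M
afterStep Nc φ M (det M′) = φ M′
afterStep Nc φ M (ran g)  = geo Nc (φ ∘ g)

-- The transpose of `reduct`: it acts on functions of terms instead of distributions, which lets a
-- run be analysed from its first step.
next : ℕ → (Tm → ℚ) → Tm → ℚ
next Nc φ M = afterStep Nc φ M (step M)

next-cong : ∀ Nc {φ ψ} → (∀ M → φ M ≡ ψ M) → ∀ M → next Nc φ M ≡ next Nc ψ M
next-cong Nc e M with step M
... | isVal  = e M
... | stuck  = e M
... | det M′ = e M′
... | ran g  = geo-cong Nc (e ∘ g)

expect-++ : ∀ φ D E → expect φ (D ++ E) ≡ expect φ D + expect φ E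
expect-++ φ []            E = sym (ℚ.+-identityˡ _)
expect-++ φ ((w , M) ∷ D) E =
  trans (cong (_+_ (w * φ M)) (expect-++ φ D E)) (sym (ℚ.+-assoc (w * φ M) (expect φ D) (expect φ E)))

-- Generalised over the enumeration `f` and the weights `a` for the induction: peeling off one
-- sample turns `f` into `f ∘ suc` and `w` into `w * ½`.
expect-map : ∀ φ (a : ℕ → ℚ) g f n w → (∀ j → a (f j) ≡ w * halfPow j) →
             expect φ (map (λ j → a j , g j) (applyUpTo f n)) ≡ w * geo n (φ ∘ g ∘ f)
expect-map φ a g f zero    w e = sym (ℚ.*-zeroʳ w)
expect-map φ a g f (suc n) w e = begin
  a (f 0) * φ (g (f 0)) + expect φ (map (λ j → a j , g j) (applyUpTo (f ∘ suc) n))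
    ≡⟨ cong₂ (λ p q → p * φ (g (f 0)) + q) (e 0) (expect-map φ a g (f ∘ suc) n (w * ½)
         (λ j → trans (e (suc j)) (sym (ℚ.*-assoc w ½ (halfPow j))))) ⟩
  w * ½ * φ (g (f 0)) + w * ½ * geo n (φ ∘ g ∘ f ∘ suc)
    ≡⟨ solve 4 (λ w h a b → w :* h :* a :+ w :* h :* b := w :* (h :* (a :+ b))) refl
         w ½ (φ (g (f 0))) (geo n (φ ∘ g ∘ f ∘ suc)) ⟩
  w * (½ * (φ (g (f 0)) + geo n (φ ∘ g ∘ f ∘ suc))) ∎
  where open ≡-Reasoning

expect-reduct : ∀ Nc φ w M → expect φ (reduct Nc (w , M)) ≡ w * next Nc φ M
expect-reduct Nc φ w M with step M
... | isVal  = ℚ.+-identityʳ _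
... | stuck  = ℚ.+-identityʳ _
... | det M′ = ℚ.+-identityʳ _
... | ran g  = expect-map φ (λ j → w * halfPow j) g id Nc w (λ _ → refl)

expect-concatMap : ∀ Nc φ D → expect φ (concatMap (reduct Nc) D) ≡ expect (next Nc φ) D
expect-concatMap Nc φ []            = refl
expect-concatMap Nc φ ((w , M) ∷ D) =
  trans (expect-++ φ (reduct Nc (w , M)) (concatMap (reduct Nc) D))
        (cong₂ _+_ (expect-reduct Nc φ w M) (expect-concatMap Nc φ D))

indicator : Tm → Tm → ℚ
indicator V M = if M == V then 1ℚ else 0ℚ

massOf-expect : ∀ V D → massOf V D ≡ expect (indicator V) D
massOf-expect V []            = refl
massOf-expect V ((w , M) ∷ D) = cong₂ _+_ (lemma (M == V)) (massOf-expect V D)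
  where
  lemma : ∀ b → (if b then w else 0ℚ) ≡ w * (if b then 1ℚ else 0ℚ)
  lemma true  = sym (ℚ.*-identityʳ w)
  lemma false = sym (ℚ.*-zeroʳ w)

nexts : ℕ → ℕ → (Tm → ℚ) → Tm → ℚ
nexts Nc zero    φ = φ
nexts Nc (suc k) φ = next Nc (nexts Nc k φ)

-- `dist` adds a step at the end of a run and `nexts` at its beginning; this reconciles the two.
nexts-next : ∀ Nc k φ M → nexts Nc k (next Nc φ) M ≡ nexts Nc (suc k) φ M
nexts-next Nc zero    φ M = refl
nexts-next Nc (suc k) φ M = next-cong Nc (nexts-next Nc k φ) M

expect-dist : ∀ Nc k φ M → expect φ (dist Nc k M) ≡ nexts Nc k φ M
expect-dist Nc zero    φ M = trans (ℚ.+-identityʳ _) (ℚ.*-identityˡ (φ M))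
expect-dist Nc (suc k) φ M = begin
  expect φ (concatMap (reduct Nc) (dist Nc k M)) ≡⟨ expect-concatMap Nc φ (dist Nc k M) ⟩
  expect (next Nc φ) (dist Nc k M)               ≡⟨ expect-dist Nc k (next Nc φ) M ⟩
  nexts Nc k (next Nc φ) M                       ≡⟨ nexts-next Nc k φ M ⟩
  nexts Nc (suc k) φ M                           ∎
  where open ≡-Reasoning

prob : ℕ → Tm → ℕ → Tm → ℚ
prob Nc V k = nexts Nc k (indicator V)

mass-prob : ∀ Nc k M V → mass Nc k M V ≡ prob Nc V k M
mass-prob Nc k M V = trans (massOf-expect V (dist Nc k M)) (expect-dist Nc k (indicator V) M)

prob-≥0 : ∀ Nc V k M → 0ℚ ≤ prob Nc V k M
prob-≥0 Nc V zero M with M == V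
... | true  = ℚ.nonNegative⁻¹ 1ℚ
... | false = ℚ.≤-refl
prob-≥0 Nc V (suc k) M with step M
... | isVal  = prob-≥0 Nc V k M
... | stuck  = prob-≥0 Nc V k M
... | det M′ = prob-≥0 Nc V k M′
... | ran g  = geo-≥0 Nc (prob-≥0 Nc V k ∘ g)

prob-≤1 : ∀ Nc V k M → prob Nc V k M ≤ 1ℚ
prob-≤1 Nc V zero M with M == V
... | true  = ℚ.≤-refl
... | false = ℚ.nonNegative⁻¹ 1ℚ
prob-≤1 Nc V (suc k) M with step M
... | isVal  = prob-≤1 Nc V k M
... | stuck  = prob-≤1 Nc V k M
... | det M′ = prob-≤1 Nc V k M′
... | ran g  = geo-≤1 Nc (prob-≤1 Nc V k ∘ g)

prob-val : ∀ Nc V k {M} → step M ≡ isVal → prob Nc V k M ≡ indicator V M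
prob-val Nc V zero    e = refl
prob-val Nc V (suc k) e rewrite e = prob-val Nc V k e

==-num : ∀ M n → (M == num n) ≡ true → M ≡ num n
==-num zer zero refl = refl
==-num (app suk M) (suc n) e = cong (app suk) (==-num M n e)
==-num (app (var _) _) (suc n) ()
==-num (app (lam _) _) (suc n) ()
==-num (app (app _ _) _) (suc n) ()
==-num (app (pair _ _) _) (suc n) ()
==-num (app pi1 _) (suc n) ()
==-num (app pi2 _) (suc n) ()
==-num (app rec _) (suc n) ()
==-num (app zer _) (suc n) ()
==-num (app rnd _) (suc n) ()
==-num zer (suc n) ()

indicator-≢ : ∀ M n → M ≢ num n → indicator (num n) M ≡ 0ℚ
indicator-≢ M n M≢n with M == num n in e
... | true  = ⊥-elim (M≢n (==-num M n e))
... | false = refl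

==-num-refl : ∀ n → (num n == num n) ≡ true
==-num-refl zero    = refl
==-num-refl (suc n) = ==-num-refl n

-- Subdistributions, their mixtures and point masses

total : Std Weights → ℕ
total = proj₁

weight : Std Weights → ℕ → ℕ
weight = proj₂

mix : Std Weights → Std Weights → Std Weights
mix = eval {[]} mixᵗ tt

total-mix : ∀ A B → total (mix A B) ≡ total A ℕ.* total B ℕ.+ total A ℕ.* total B
total-mix A B =
  trans (plus-correct (times (total A) (total B)) (times (total A) (total B)))
        (cong₂ ℕ._+_ (times-correct (total A) (total B)) (times-correct (total A) (total B)))

weight-mix : ∀ A B v → weight (mix A B) v ≡ weight A v ℕ.* total B ℕ.+ weight B v ℕ.* total A
weight-mix A B v =
  trans (plus-correct (times (weight A v) (total B)) (times (weight B v) (total A)))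
        (cong₂ ℕ._+_ (times-correct (weight A v) (total B)) (times-correct (weight B v) (total A)))

-- `disjoint` is the pairwise form of total mass at most one, which makes a majority outcome unique;
-- `support` bounds the search for it.
record Subdistribution (A : Std Weights) : Set where
  field
    positive : 0 ℕ.< total A
    support  : ∀ {v} → total A ℕ.≤ v → weight A v ≡ 0
    disjoint : ∀ {u v} → u ≢ v → weight A u ℕ.+ weight A v ℕ.≤ total A

open Subdistribution

mix-subdistribution : ∀ {A B} → Subdistribution A → Subdistribution B → Subdistribution (mix A B)
mix-subdistribution {A} {B} a b = record
  { positive = transport (0 ℕ.<_) (sym (total-mix A B)) (ℕ.<-≤-trans 0<MN (ℕ.m≤m+n (M ℕ.* N) (M ℕ.* N)))
  -- Since `M` and `N` are positive, the new denominator `2MN` is at least each of them.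
  ; support  = λ {v} le → trans (weight-mix A B v) (cong₂ (λ p q → p ℕ.* N ℕ.+ q ℕ.* M)
      (support a (ℕ.≤-trans M≤ (transport (ℕ._≤ v) (total-mix A B) le)))
      (support b (ℕ.≤-trans N≤ (transport (ℕ._≤ v) (total-mix A B) le))))
  ; disjoint = λ {u} {v} u≢v → begin
      weight (mix A B) u ℕ.+ weight (mix A B) v
        ≡⟨ cong₂ ℕ._+_ (weight-mix A B u) (weight-mix A B v) ⟩
      (weight A u ℕ.* N ℕ.+ weight B u ℕ.* M) ℕ.+ (weight A v ℕ.* N ℕ.+ weight B v ℕ.* M)
        ≡⟨ rearrange (weight A u) (weight B u) (weight A v) (weight B v) M N ⟩
      (weight A u ℕ.+ weight A v) ℕ.* N ℕ.+ (weight B u ℕ.+ weight B v) ℕ.* M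
        ≤⟨ ℕ.+-mono-≤ (ℕ.*-monoˡ-≤ N (disjoint a u≢v)) (ℕ.*-monoˡ-≤ M (disjoint b u≢v)) ⟩
      M ℕ.* N ℕ.+ N ℕ.* M
        ≡⟨ cong (M ℕ.* N ℕ.+_) (ℕ.*-comm N M) ⟩
      M ℕ.* N ℕ.+ M ℕ.* N
        ≡⟨ total-mix A B ⟨
      total (mix A B) ∎
  }
  where
  open ℕ.≤-Reasoning
  M = total A
  N = total B
  0<MN : 0 ℕ.< M ℕ.* N
  0<MN = ℕ.*-mono-≤ (positive a) (positive b)
  M≤ : M ℕ.≤ M ℕ.* N ℕ.+ M ℕ.* N
  M≤ = ℕ.≤-trans (ℕ.m≤m*n M N {{ℕ.>-nonZero (positive b)}}) (ℕ.m≤m+n _ _)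
  N≤ : N ℕ.≤ M ℕ.* N ℕ.+ M ℕ.* N
  N≤ = ℕ.≤-trans (ℕ.m≤n*m N M {{ℕ.>-nonZero (positive a)}}) (ℕ.m≤m+n _ _)
  rearrange : ∀ a b c d m n → (a ℕ.* n ℕ.+ b ℕ.* m) ℕ.+ (c ℕ.* n ℕ.+ d ℕ.* m) ≡
                              (a ℕ.+ c) ℕ.* n ℕ.+ (b ℕ.+ d) ℕ.* m
  rearrange = ℕ-solve-∀

mixtures-subdistribution : ∀ n {c} → (∀ j → Subdistribution (c j)) → Subdistribution (mixtures n c)
mixtures-subdistribution zero    p = record { positive = s≤s z≤n ; support = λ _ → refl ; disjoint = λ _ → z≤n }
mixtures-subdistribution (suc n) p = mix-subdistribution (p 0) (mixtures-subdistribution n (p ∘ suc))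

point : ℕ → Std Answer
point = eval {[]} pointᵗ tt

-- The equality test inside `pointᵗ`: the distance vanishes exactly on equal arguments.
distance : ∀ m n → plus (monus m n) (monus n m) ≡ ℕ.∣ m - n ∣
distance m n = trans (plus-correct (monus m n) (monus n m))
  (trans (cong₂ ℕ._+_ (monus-correct m n) (monus-correct n m)) (∸-∸ m n))
  where
  ∸-∸ : ∀ m n → (m ℕ.∸ n) ℕ.+ (n ℕ.∸ m) ≡ ℕ.∣ m - n ∣
  ∸-∸ zero    zero    = refl
  ∸-∸ zero    (suc n) = refl
  ∸-∸ (suc m) zero    = ℕ.+-identityʳ (suc m)
  ∸-∸ (suc m) (suc n) = ∸-∸ m n

weight-point-≡ : ∀ n s → weight (point n s) n ≡ suc n
weight-point-≡ n s rewrite distance n n | ℕ.∣n-n∣≡0 n = refl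

weight-point-≢ : ∀ {n v} s → n ≢ v → weight (point n s) v ≡ 0
weight-point-≢ {n} {v} s n≢v rewrite distance n v with ℕ.∣ n - v ∣ in e
... | zero  = ⊥-elim (n≢v (ℕ.∣m-n∣≡0⇒m≡n e))
... | suc _ = refl

point-subdistribution : ∀ n s → Subdistribution (point n s)
point-subdistribution n s = record
  { positive = s≤s z≤n
  ; support  = λ {v} n<v → weight-point-≢ s (ℕ.<⇒≢ n<v)
  ; disjoint = disj
  }
  where
  weight-≤ : ∀ v → weight (point n s) v ℕ.≤ suc n
  weight-≤ v with n ℕ.≟ v
  ... | yes refl = ℕ.≤-reflexive (weight-point-≡ n s)
  ... | no n≢v   = ℕ.≤-trans (ℕ.≤-reflexive (weight-point-≢ s n≢v)) z≤n
  disj : ∀ {u v} → u ≢ v → weight (point n s) u ℕ.+ weight (point n s) v ℕ.≤ suc n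
  disj {u} {v} u≢v with n ℕ.≟ u
  ... | no n≢u rewrite weight-point-≢ s n≢u = weight-≤ v
  ... | yes refl rewrite weight-point-≢ s u≢v | ℕ.+-identityʳ (weight (point n s) n) = weight-≤ n

-- q ≤ weight A v / total A, with the denominator cleared
_at_dominates_ : Std Weights → ℕ → ℚ → Set
A at v dominates q = q * fromℕ (total A) ≤ fromℕ (weight A v)

dominates-mono : ∀ A {v p q} → p ≤ q → A at v dominates q → A at v dominates p
dominates-mono A p≤q dom =
  ℚ.≤-trans (ℚ.*-monoʳ-≤-nonNeg (fromℕ (total A)) {{fromℕ-nonNeg (total A)}} p≤q) dom

dominates-nonPos : ∀ A {v q} → q ≤ 0ℚ → A at v dominates q
dominates-nonPos A {v} q≤0 = dominates-mono A {v} q≤0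
  (ℚ.≤-trans (ℚ.≤-reflexive (ℚ.*-zeroˡ (fromℕ (total A)))) (fromℕ-≥0 (weight A v)))

dominates-mix : ∀ {A B v p q} → A at v dominates p → B at v dominates q →
                mix A B at v dominates (½ * (p + q))
dominates-mix {A} {B} {v} {p} {q} a b = begin
  ½ * (p + q) * fromℕ (total (mix A B))
    ≡⟨ cong (λ t → ½ * (p + q) * fromℕ t) (total-mix A B) ⟩
  ½ * (p + q) * fromℕ (total A ℕ.* total B ℕ.+ total A ℕ.* total B)
    ≡⟨ cong (_*_ (½ * (p + q))) (trans
         (fromℕ-+ (total A ℕ.* total B) (total A ℕ.* total B))
         (cong₂ _+_ (fromℕ-* (total A) (total B)) (fromℕ-* (total A) (total B)))) ⟩
  ½ * (p + q) * (M * N + M * N)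
    ≡⟨ solve 4 (λ p q m n → con ½ :* (p :+ q) :* (m :* n :+ m :* n)
                            := p :* m :* n :+ q :* n :* m) refl p q M N ⟩
  p * M * N + q * N * M
    ≤⟨ ℚ.+-mono-≤ (ℚ.*-monoʳ-≤-nonNeg N {{fromℕ-nonNeg (total B)}} a)
                  (ℚ.*-monoʳ-≤-nonNeg M {{fromℕ-nonNeg (total A)}} b) ⟩
  fromℕ (weight A v) * N + fromℕ (weight B v) * M
    ≡⟨ cong₂ _+_ (fromℕ-* (weight A v) (total B)) (fromℕ-* (weight B v) (total A)) ⟨
  fromℕ (weight A v ℕ.* total B) + fromℕ (weight B v ℕ.* total A)
    ≡⟨ fromℕ-+ (weight A v ℕ.* total B) (weight B v ℕ.* total A) ⟨
  fromℕ (weight A v ℕ.* total B ℕ.+ weight B v ℕ.* total A)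
    ≡⟨ cong fromℕ (weight-mix A B v) ⟨
  fromℕ (weight (mix A B) v) ∎
  where
  open ℚ.≤-Reasoning
  M = fromℕ (total A)
  N = fromℕ (total B)

-- `mixtures` and `geo` follow the same Horner recursion.
dominates-mixtures : ∀ n c v x → (∀ j → c j at v dominates x j) → mixtures n c at v dominates geo n x
dominates-mixtures zero    c v x p = ℚ.≤-reflexive (trans (ℚ.*-zeroˡ (fromℕ 1)) (sym fromℕ-0))
dominates-mixtures (suc n) c v x p =
  dominates-mix {c 0} {mixtures n (c ∘ suc)} {v} {x 0} {geo n (x ∘ suc)}
    (p 0) (dominates-mixtures n (c ∘ suc) v (x ∘ suc) (p ∘ suc))

p-q≤0 : ∀ {p q} → p ≤ q → p - q ≤ 0ℚ
p-q≤0 {p} {q} p≤q = ℚ.≤-trans (ℚ.+-monoˡ-≤ (- q) p≤q) (ℚ.≤-reflexive (ℚ.+-inverseʳ q))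

p-q≤p : ∀ p {q} → 0ℚ ≤ q → p - q ≤ p
p-q≤p p 0≤q = ℚ.≤-trans (ℚ.+-monoʳ-≤ p (ℚ.neg-antimono-≤ 0≤q)) (ℚ.≤-reflexive (ℚ.+-identityʳ p))

-- Correctness of the majority program

open Fundamental cpsModel

-- Induction on the evaluation tree for all precisions at once, as each sampling raises the
-- precision.
answer-subdistribution : ∀ {M m} → Comp (R nat) M m → ∀ s → Subdistribution (m point s)
answer-subdistribution (val _ (n , refl , refl) e) s rewrite e point = point-subdistribution n s
answer-subdistribution (det _ c)   s = answer-subdistribution c s
answer-subdistribution (ran _ c e) s rewrite e point =
  mixtures-subdistribution (suc s) (λ j → answer-subdistribution (c j) (suc s))

-- A term that is not a value carries no mass on a numeral, so the bound to be dominated is at most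
-- zero.
dominates-nonvalue : ∀ A M v s → step M ≢ isVal → A at v dominates (indicator (num v) M - power s)
dominates-nonvalue A M v s M-step = dominates-nonPos A {v} (p-q≤0 (ℚ.≤-trans
  (ℚ.≤-reflexive (indicator-≢ M v λ { refl → M-step (step-num v) })) (power-≥0 s)))

point-dominates : ∀ n v s → point n s at v dominates (indicator (num v) (num n) - power s)
point-dominates n v s with n ℕ.≟ v
... | no n≢v   = dominates-nonPos (point n s) {v} (p-q≤0 (ℚ.≤-trans
      (ℚ.≤-reflexive (indicator-≢ (num n) v (n≢v ∘ num-injective))) (power-≥0 s)))
... | yes refl rewrite ==-num-refl n = dominates-mono (point n s) {n} (p-q≤p 1ℚ (power-≥0 s))
      (ℚ.≤-reflexive (trans (ℚ.*-identityˡ (fromℕ (suc n))) (cong fromℕ (sym (weight-point-≡ n s)))))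

-- The answer at precision `s` misses at most `2^-s`, uniformly in the truncation `Nc` and the
-- number `k` of steps. The proof is by induction on the evaluation tree.
answer-dominates : ∀ {M m} → Comp (R nat) M m → ∀ Nc k v s →
                   m point s at v dominates (prob Nc (num v) k M - power s)
answer-dominates (val e (n , refl , refl) e′) Nc k v s =
  transport₂ (λ a q → a s at v dominates (q - power s))
    (sym (e′ point)) (sym (prob-val Nc (num v) k e)) (point-dominates n v s)
answer-dominates {M} {m} (det e c) Nc zero v s =
  dominates-nonvalue (m point s) M v s λ e′ → case trans (sym e) e′ of λ ()
answer-dominates (det e c) Nc (suc k) v s rewrite e = answer-dominates c Nc k v s
answer-dominates {M} {m} (ran e c _) Nc zero v s =
  dominates-nonvalue (m point s) M v s λ e′ → case trans (sym e) e′ of λ ()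
answer-dominates {M} (ran {g = g} {ms = ms} e c e′) Nc (suc k) v s =
  transport (λ a → a s at v dominates (prob Nc (num v) (suc k) M - power s)) (sym (e′ point))
    (dominates-mono (mixtures (suc s) λ j → ms j point (suc s)) {v} bound
      (dominates-mixtures (suc s) (λ j → ms j point (suc s)) v (λ j → φ (g j) - power (suc s))
        (λ j → answer-dominates (c j) Nc k v (suc s))))
  where
  open ℚ.≤-Reasoning
  φ : Tm → ℚ
  φ = prob Nc (num v) k
  -- The error `2^-s` splits into two halves: one pays for the samples beyond `s`, the other for the
  -- error of the branches at precision `s + 1`.
  bound : prob Nc (num v) (suc k) M - power s ≤ geo (suc s) (λ j → φ (g j) - power (suc s))
  bound = begin
    afterStep Nc φ M (step M) - power s
      ≡⟨ cong (λ t → afterStep Nc φ M t - power s) e ⟩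
    geo Nc (φ ∘ g) - power s
      ≤⟨ ℚ.+-monoˡ-≤ (- power s) (geo-tail Nc (suc s) {φ ∘ g}
           (prob-≥0 Nc (num v) k ∘ g) (prob-≤1 Nc (num v) k ∘ g)) ⟩
    geo (suc s) (φ ∘ g) + ½ * power s - power s
      ≡⟨ solve 2 (λ a p → a :+ con ½ :* p :- p := a :- con ½ :* p) refl
           (geo (suc s) (φ ∘ g)) (power s) ⟩
    geo (suc s) (φ ∘ g) - power (suc s)
      ≤⟨ geo-shift (suc s) {φ ∘ g} (power-≥0 (suc s)) ⟩
    geo (suc s) (λ j → φ (g j) - power (suc s)) ∎

majority : Std Weights → ℕ
majority = eval {[]} majorityᵗ tt

-- Two distinct outcomes above one half would violate `disjoint`, so only `v` passes the test;
-- `support` places `v` within the range of the search.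
majority-correct : ∀ {A} → Subdistribution A →
                   ∀ {v} → total A ℕ.< weight A v ℕ.+ weight A v → majority A ≡ v
majority-correct {A} a {v} v-major = search (total A) v<total
  where
  N = total A
  w = weight A
  unique : ∀ {u} → N ℕ.< w u ℕ.+ w u → u ≡ v
  unique {u} u-major with u ℕ.≟ v
  ... | yes u≡v = u≡v
  ... | no u≢v  = ⊥-elim (ℕ.<-irrefl refl (begin-strict
    N ℕ.+ N                             <⟨ ℕ.+-mono-< u-major v-major ⟩
    (w u ℕ.+ w u) ℕ.+ (w v ℕ.+ w v)     ≡⟨ rearrange (w u) (w v) ⟩
    (w u ℕ.+ w v) ℕ.+ (w u ℕ.+ w v)     ≤⟨ ℕ.+-mono-≤ (disjoint a u≢v) (disjoint a u≢v) ⟩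
    N ℕ.+ N                             ∎))
    where
    open ℕ.≤-Reasoning
    rearrange : ∀ a b → (a ℕ.+ a) ℕ.+ (b ℕ.+ b) ≡ (a ℕ.+ b) ℕ.+ (a ℕ.+ b)
    rearrange = ℕ-solve-∀
  v<total : v ℕ.< N
  v<total with v ℕ.<? N
  ... | yes p = p
  ... | no ¬p with support a (ℕ.≮⇒≥ ¬p)
  ...   | e with () ← transport (λ x → N ℕ.< x ℕ.+ x) e v-major
  test : ∀ u → monus (suc N) (plus (w u) (w u)) ≡ suc N ℕ.∸ (w u ℕ.+ w u)
  test u = trans (monus-correct (suc N) (plus (w u) (w u))) (cong (suc N ℕ.∸_) (plus-correct (w u) (w u)))
  choose : ℕ → ℕ → ℕ
  choose u r = ifZero (monus (suc N) (plus (w u) (w u))) u r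
  search : ∀ k → v ℕ.< k → primrec 0 choose k ≡ v
  search (suc k) v<1+k rewrite test k with suc N ℕ.∸ (w k ℕ.+ w k) in e
  ... | zero  = unique (ℕ.m∸n≡0⇒m≤n e)
  ... | suc _ = search k (ℕ.≤∧≢⇒< (ℕ.s≤s⁻¹ v<1+k) λ { refl → ℕ.0≢1+n (trans (sym (ℕ.m≤n⇒m∸n≡0 v-major)) e) })

majority-dominated : ∀ {A v q} → A at v dominates q → ½ < q → Subdistribution A →
                     total A ℕ.< weight A v ℕ.+ weight A v
majority-dominated {A} {v} {q} dom ½<q a = ℕ.≰⇒> λ 2w≤N → ℚ.<-irrefl refl (begin-strict
  fromℕ N                              ≡⟨ halves (fromℕ N) ⟨
  ½ * fromℕ N + ½ * fromℕ N            <⟨ ℚ.+-mono-< lt lt ⟩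
  q * fromℕ N + q * fromℕ N            ≤⟨ ℚ.+-mono-≤ dom dom ⟩
  fromℕ w + fromℕ w                    ≡⟨ fromℕ-+ w w ⟨
  fromℕ (w ℕ.+ w)                      ≤⟨ fromℕ-mono 2w≤N ⟩
  fromℕ N                              ∎)
  where
  open ℚ.≤-Reasoning
  N = total A
  w = weight A v
  lt : ½ * fromℕ N < q * fromℕ N
  lt = ℚ.*-monoˡ-<-pos (fromℕ N) {{fromℕ-pos (positive a)}} ½<q

BPf⇒DT : ∀ f → BPf f → DT f
BPf⇒DT f (h , (H , ⊢H , noR-H , H-runs) , h≢0 , M , ⊢M , M-gt) =
  raw program , typing program , noR program ,
  λ n → transport (λ v → app (raw program) (num n) ⟶* num v) (program-correct n)
          (Adequacy.adequacy (typing program) (noR program) n)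
  where
  program : Term [] (nat ⇒ nat)
  program = majorityOutputᵗ · translate ⊢M · term ⊢H noR-H
  h-correct : ∀ n → std ⊢H tt n ≡ h n
  -- By adequacy the standard denotation of `H` is also a result of its reduction, which is
  -- deterministic.
  h-correct n = ⟶*-num-unique (Adequacy.adequacy ⊢H noR-H n) (H-runs n)
  program-correct : ∀ n → eval program tt n ≡ f n
  program-correct n rewrite h-correct n with M-gt n
  ... | Nc , k , gt = majority-correct A (majority-dominated {v = f n}
          (answer-dominates c Nc k (f n) (h n)) ½<q A)
    where
    c = fundamental-num ⊢M n
    A = answer-subdistribution c (h n)
    P = prob Nc (num (f n)) k (app M (num n))
    open ℚ.≤-Reasoning
    ½<q : ½ < P - power (h n)
    ½<q = begin-strict
      ½                                  ≡⟨ solve 2 (λ a p → a := a :+ p :- p) refl ½ (power (h n)) ⟩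
      ½ + power (h n) - power (h n)      ≤⟨ ℚ.+-monoˡ-≤ (- power (h n)) (ℚ.+-monoʳ-≤ ½ (power-≤-recip (h≢0 n))) ⟩
      ½ + recip (h n) - power (h n)      <⟨ ℚ.+-monoˡ-< (- power (h n))
                                              (transport (½ + recip (h n) <_)
                                                (mass-prob Nc k (app M (num n)) (num (f n))) gt) ⟩
      P - power (h n)                    ∎

-- The converse inclusions and the class with error bound 1/3

constant : ∀ c → DT (λ _ → c)
constant c = lam (num c) , ⊢lam (⊢num c) , Adequacy.NoR-num c ,
  λ n → more (trans (step-redex (lam (num c)) (num n) refl (step-num n))
                    (cong det (subst-scoped-id (num c) (num-closed c) z≤n))) done
  where
  ⊢num : ∀ {Γ} n → Γ ⊢ num n ∶ nat
  ⊢num zero    = ⊢zer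
  ⊢num (suc n) = ⊢app ⊢suk (⊢num n)

-- A sequence of `det` steps never samples, so nothing is lost by keeping `0` outcomes of each
-- sample.
⟶*-prob : ∀ {M v} → M ⟶* num v → ∃ λ k → prob 0 (num v) k M ≡ 1ℚ
⟶*-prob {v = v} done = 0 , cong (λ b → if b then 1ℚ else 0ℚ) (==-num-refl v)
⟶*-prob {v = v} (more {M} {M′} e r) with ⟶*-prob r
... | k , p = suc k , trans (cong (afterStep 0 (prob 0 (num v) k) M) e) p

⟶*-EvalGt : ∀ {M v q} → q < 1ℚ → M ⟶* num v → EvalGt M (num v) q
⟶*-EvalGt {M} {v} {q} q<1 r with ⟶*-prob r
... | k , p = 0 , k , transport (q <_) (sym (trans (mass-prob 0 k M (num v)) p)) q<1

DT⇒BPf : ∀ f → DT f → BPf f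
DT⇒BPf f (M , ⊢M , _ , runs) =
  -- `3` is the least positive constant `h` for which `½ + 1/h` is below the probability `1` of the
  -- result.
  (λ _ → 3) , constant 3 , (λ _ ()) , M , ⊢M ,
  λ n → ⟶*-EvalGt (from-yes (½ + recip 3 ℚ.<? 1ℚ)) (runs n)

DT⇒BP : ∀ f → DT f → BP f
DT⇒BP f (M , ⊢M , _ , runs) = M , ⊢M , λ n ε 0<ε →
  ⟶*-EvalGt (ℚ.≤-<-trans (p-q≤p twoThirds (ℚ.<⇒≤ 0<ε)) (from-yes (twoThirds ℚ.<? 1ℚ))) (runs n)

-- 1/2 + 1/12 = 2/3 - 1/12
BP⇒BPf : ∀ f → BP f → BPf f
BP⇒BPf f (M , ⊢M , geq) =
  (λ _ → 12) , constant 12 , (λ _ ()) , M , ⊢M ,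
  λ n → geq n (recip 12) (from-yes (0ℚ ℚ.<? recip 12))

mainTheorem9 : (f : ℕ → ℕ) → (BPf f ⇔ DT f) × (BP f ⇔ DT f)
mainTheorem9 f = mk⇔ (BPf⇒DT f) (DT⇒BPf f) , mk⇔ (BPf⇒DT f ∘ BP⇒BPf f) (DT⇒BP f)
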